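{- Let $n$ be a positive integer and let $q=p^r \equiv 1 \pmod n$ be a power of an odd prime $p$. Let $m\in\mathbb{Z}^+$ and $a_1,\dots,a_m,b_1,\dots,b_m\in\mathbb{Q}\cap\mathbb{Z}_p$. If $\lambda \in \mathbb{F}_q$ is not an $n$-th power in $\mathbb{F}_q$, then $${}_{nm}G_{nm}\left[ \begin{array}{c} a_i+\frac{l}{n} : 1 \leq i \leq m,\ 0 \leq l \leq n-1 \\ b_i+\frac{l}{n} : 1 \leq i \leq m,\ 0 \leq l \leq n-1 \end{array} \Big| \; \lambda \right]_q =0.$$
   Context: $\mathbb{Z}_p$ is the ring of $p$-adic integers and $\Gamma_p$ is Morita's $p$-adic gamma function: $\Gamma_p(n):=(-1)^n\prod_{0<j<n,\,p\nmid j}j$ for $n\in\mathbb{Z}^+$, extended continuously to $\mathbb{Z}_p$, with $\Gamma_p(0)=1$. $\omega:\mathbb{F}_q^*\to\mathbb{Z}_q^{\times}$ is the Teichmüller character ($\mathbb{Z}_q$ the ring of integers of the unramified extension of $\mathbb{Q}_p$ with residue field $\mathbb{F}_q$; $\omega(x)$ is the $(q-1)$-st root of unity congruent to $x$ mod $p$), $\overline{\omega}$ is its inverse, and all powers (including the trivial one) are extended by the value $0$ at $0\in\mathbb{F}_q$. For $x\in\mathbb{Q}$, $\lfloor x\rfloor$ is the floor and $\langle x\rangle=x-\lfloor x\rfloor$. Definition of ${}_mG_m$: for $q=p^r$, $p$ an odd prime, $\lambda\in\mathbb{F}_q$, $a_i,b_i\in\mathbb{Q}\cap\mathbb{Z}_p$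 ($1\le i\le m$), $${}_{m}G_{m}\left[ \begin{array}{ccc} a_1, & \dots, & a_m \\ b_1, & \dots, & b_m \end{array} \Big| \; \lambda \right]_q := \frac{ -1}{q-1} \sum_{j=0}^{q-2} (-1)^{jm}\, \overline{\omega}^j(\lambda) \prod_{i=1}^{m} \prod_{k=0}^{r-1} \frac{\Gamma_p(\langle (a_i -\frac{j}{q-1} )p^k \rangle)}{\Gamma_p(\langle a_i p^k \rangle)} \frac{\Gamma_p(\langle (-b_i +\frac{j}{q-1}) p^k \rangle)}{\Gamma_p(\langle -b_i p^k\rangle)} (-p)^{ -\lfloor\langle a_i p^k \rangle -\frac{j p^k}{q-1}\rfloor -\lfloor\langle -b_i p^k\rangle +\frac{j p^k}{q-1}\rfloor}.$$ -}

module Defs where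

open import Algebra.Bundles using (CommutativeRing)
open import Algebra.Morphism.Structures using (module RingMorphisms)
import Algebra.Properties.Monoid.Sum
import Algebra.Properties.Ring
import Algebra.Properties.Semiring.Exp
import Algebra.Properties.Semiring.Sum
import Algebra.Solver.Ring.NaturalCoefficients.Default
open import Data.Fin.Base using (Fin; toℕ; remQuot)
import Data.Fin.Properties as FinP
open import Data.Integer.Base as ℤ using (ℤ; +_; -[1+_]; 0ℤ; 1ℤ; -1ℤ; ∣_∣)
open import Data.Integer.DivMod using (_%ℕ_; _/ℕ_; a≡a%ℕn+[a/ℕn]*n; n%ℕd<d)
open import Data.Integer.Divisibility.Signed as ℤD using (divides)
import Data.Integer.Properties as ℤP
open import Data.Integer.Tactic.RingSolver using (solve-∀)
open import Data.List.Base using (List; []; _∷_; _++_; _∷ʳ_; [_]; filter; upTo; length)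
open import Data.List.Membership.Propositional using (_∈_; _∉_)
open import Data.List.Membership.Propositional.Properties using (∈-∃++; ∈-filter⁺; ∈-filter⁻; ∈-upTo⁺; ∈-upTo⁻)
open import Data.List.Properties using (upTo-∷ʳ; filter-++)
open import Data.List.Relation.Binary.Permutation.Propositional as ↭ using (_↭_; ↭-sym)
open import Data.List.Relation.Binary.Permutation.Propositional.Properties using (shift; ∈-resp-↭; All-resp-↭; ↭-length)
open import Data.List.Relation.Unary.All as All using (All; []; _∷_)
import Data.List.Relation.Unary.All.Properties as All
open import Data.List.Relation.Unary.AllPairs as AllPairs using ([]; _∷_)
open import Data.List.Relation.Unary.Any using (here; there)
open import Data.List.Relation.Unary.Unique.Propositional using (Unique)
import Data.List.Relation.Unary.Unique.Propositional.Properties as Unique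
open import Data.Nat.Base as ℕ using (ℕ; zero; suc; NonZero; s≤s; z≤n)
import Data.Nat.DivMod as ℕM
import Data.Nat.Divisibility as ℕD
open import Data.Nat.GCD using (module GCD; module Bézout)
open import Data.Nat.ListAction using (product)
open import Data.Nat.ListAction.Properties using (product-++; product-↭)
open import Data.Nat.Primality using (Prime; prime⇒nonZero; prime⇒nonTrivial; prime⇒irreducible; euclidsLemma)
import Data.Nat.Properties as ℕP
open import Data.Product.Base using (∃; _×_; _,_; proj₁; proj₂)
open import Data.Rational.Base as ℚ using (ℚ; ↥_; ↧_; ↧ₙ_; floor)
open import Data.Sum.Base using (_⊎_; inj₁; inj₂; [_,_]′)
open import Function.Base using (_∘_)
open import Function.Bundles using (Inverse; _⇔_)
open import Level as Level using (0ℓ; _⊔_)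
open import Relation.Binary.PropositionalEquality as ≡ using (_≡_; _≢_; refl; cong; cong₂; subst)
open import Relation.Nullary using (¬_; Dec; yes; no; contradiction; ¬?; map′)

infix 4 _≡_mod_

record _≡_mod_ (a b : ℤ) (M : ℕ) : Set where
  constructor mod-intro
  field ∣difference : + M ℤD.∣ a ℤ.- b

open _≡_mod_ public

module _ {M : ℕ} where

  ≡⇒mod : ∀ {a b} → a ≡ b → a ≡ b mod M
  ≡⇒mod {a} refl = mod-intro (divides 0ℤ (lem a (+ M)))
    where
    lem : ∀ a M → a ℤ.- a ≡ 0ℤ ℤ.* M
    lem = solve-∀

  mod-refl : ∀ {a} → a ≡ a mod M
  mod-refl = ≡⇒mod refl

  mod-sym : ∀ {a b} → a ≡ b mod M → b ≡ a mod M
  mod-sym {a} {b} (mod-intro d) = mod-intro (subst (+ M ℤD.∣_) (lem a b) (ℤD.∣m⇒∣-m d))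
    where
    lem : ∀ a b → ℤ.- (a ℤ.- b) ≡ b ℤ.- a
    lem = solve-∀

  mod-trans : ∀ {a b c} → a ≡ b mod M → b ≡ c mod M → a ≡ c mod M
  mod-trans {a} {b} {c} (mod-intro d) (mod-intro e) =
    mod-intro (subst (+ M ℤD.∣_) (lem a b c) (ℤD.∣m∣n⇒∣m+n d e))
    where
    lem : ∀ a b c → (a ℤ.- b) ℤ.+ (b ℤ.- c) ≡ a ℤ.- c
    lem = solve-∀

  mod-+ : ∀ {a b c d} → a ≡ b mod M → c ≡ d mod M → a ℤ.+ c ≡ b ℤ.+ d mod M
  mod-+ {a} {b} {c} {d} (mod-intro e) (mod-intro f) =
    mod-intro (subst (+ M ℤD.∣_) (lem a b c d) (ℤD.∣m∣n⇒∣m+n e f))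
    where
    lem : ∀ a b c d → (a ℤ.- b) ℤ.+ (c ℤ.- d) ≡ (a ℤ.+ c) ℤ.- (b ℤ.+ d)
    lem = solve-∀

  mod-neg : ∀ {a b} → a ≡ b mod M → ℤ.- a ≡ ℤ.- b mod M
  mod-neg {a} {b} (mod-intro e) = mod-intro (subst (+ M ℤD.∣_) (lem a b) (ℤD.∣m⇒∣-m e))
    where
    lem : ∀ a b → ℤ.- (a ℤ.- b) ≡ (ℤ.- a) ℤ.- (ℤ.- b)
    lem = solve-∀

  mod-* : ∀ {a b c d} → a ≡ b mod M → c ≡ d mod M → a ℤ.* c ≡ b ℤ.* d mod M
  mod-* {a} {b} {c} {d} (mod-intro e) (mod-intro f) =
    mod-intro (subst (+ M ℤD.∣_) (lem a b c d) (ℤD.∣m∣n⇒∣m+n (ℤD.∣n⇒∣m*n a f) (ℤD.∣m⇒∣m*n d e)))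
    where
    lem : ∀ a b c d → a ℤ.* (c ℤ.- d) ℤ.+ (a ℤ.- b) ℤ.* d ≡ a ℤ.* c ℤ.- b ℤ.* d
    lem = solve-∀

  mod-*ˡ : ∀ a {c d} → c ≡ d mod M → a ℤ.* c ≡ a ℤ.* d mod M
  mod-*ˡ a = mod-* (mod-refl {a})

  mod-*ʳ : ∀ a {c d} → c ≡ d mod M → c ℤ.* a ≡ d ℤ.* a mod M
  mod-*ʳ a e = mod-* e (mod-refl {a})

  %ℕ-mod : .{{_ : NonZero M}} → ∀ a → + (a %ℕ M) ≡ a mod M
  %ℕ-mod a = mod-sym (mod-intro (divides (a /ℕ M)
    (≡.trans (cong (ℤ._- + (a %ℕ M)) (a≡a%ℕn+[a/ℕn]*n a M)) (lem (+ (a %ℕ M)) ((a /ℕ M) ℤ.* + M)))))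
    where
    lem : ∀ r t → (r ℤ.+ t) ℤ.- r ≡ t
    lem = solve-∀

  private
    close : ∀ {u v} → u ℕ.≤ v → v ℕ.< M → M ℕD.∣ v ℕ.∸ u → u ≡ v
    close {u} {v} u≤v v<M M∣ with v ℕ.∸ u in eq
    ... | zero  = ℕP.≤-antisym u≤v (ℕP.m∸n≡0⇒m≤n eq)
    ... | suc k = contradiction (ℕD.∣⇒≤ M∣)
                    (ℕP.<⇒≱ (ℕP.≤-<-trans (ℕP.≤-trans (ℕP.≤-reflexive (≡.sym eq)) (ℕP.m∸n≤m v u)) v<M))

  mod⇒≡ : .{{_ : NonZero M}} → ∀ {u v} → u ℕ.< M → v ℕ.< M → + u ≡ + v mod M → u ≡ v
  mod⇒≡ {u} {v} u<M v<M (mod-intro d) with ℕP.≤-total u v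
  ... | inj₁ u≤v = close u≤v v<M
        (subst (M ℕD.∣_) (≡.trans (cong ∣_∣ (ℤP.m-n≡m⊖n u v)) (ℤP.∣⊖∣-≤ u≤v)) (ℤD.∣⇒∣ᵤ d))
  ... | inj₂ v≤u = ≡.sym (close v≤u u<M
        (subst (M ℕD.∣_) (cong ∣_∣ (≡.trans (ℤP.m-n≡m⊖n u v) (ℤP.⊖-≥ v≤u))) (ℤD.∣⇒∣ᵤ d)))

mod-1 : ∀ {a b} → a ≡ b mod 1
mod-1 {a} {b} = mod-intro (divides (a ℤ.- b) (≡.sym (ℤP.*-identityʳ (a ℤ.- b))))

mod-∣ : ∀ {M M′ a b} → M ℕD.∣ M′ → a ≡ b mod M′ → a ≡ b mod M
mod-∣ {M} {M′} M∣M′ (mod-intro d) = mod-intro (ℤD.∣-trans (ℤD.∣ᵤ⇒∣ M∣M′) d)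

inverse-unique : ∀ {M a y z} → a ℤ.* y ≡ 1ℤ mod M → a ℤ.* z ≡ 1ℤ mod M → y ≡ z mod M
inverse-unique {M} {a} {y} {z} ay az =
  mod-trans (≡⇒mod (≡.sym (ℤP.*-identityʳ y)))
  (mod-trans (mod-*ˡ y (mod-sym az))
  (mod-trans (≡⇒mod (lem y a z))
  (mod-trans (mod-*ʳ z ay) (≡⇒mod (ℤP.*-identityˡ z)))))
  where
  lem : ∀ y a z → y ℤ.* (a ℤ.* z) ≡ (a ℤ.* y) ℤ.* z
  lem = solve-∀

∣⇒mod : ∀ {M n} → M ℕD.∣ n → + n ≡ 0ℤ mod M
∣⇒mod {M} {n} M∣n = mod-intro (subst (+ M ℤD.∣_) (≡.sym (ℤP.+-identityʳ (+ n))) (ℤD.∣ᵤ⇒∣ M∣n))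

mod⇒∣ : ∀ {M n} → + n ≡ 0ℤ mod M → M ℕD.∣ n
mod⇒∣ {M} {n} (mod-intro d) = ℤD.∣⇒∣ᵤ (subst (+ M ℤD.∣_) (ℤP.+-identityʳ (+ n)) d)

module Padic (p : ℕ) (p-prime : Prime p) where

  instance
    p≢0 : NonZero p
    p≢0 = prime⇒nonZero p-prime

  p^≢0 : ∀ N → NonZero (p ℕ.^ N)
  p^≢0 N = ℕP.m^n≢0 p N

  -- The inverse limit of the rings ℤ / pᴺ.
  record ℤₚ : Set where
    constructor _,ₚ_
    field
      residue  : ℕ → ℤ
      coherent : ∀ N → residue (suc N) ≡ residue N mod (p ℕ.^ N)

  open ℤₚ public

  infixr 4 _,ₚ_
  infix 4 _≈ₚ_

  record _≈ₚ_ (x y : ℤₚ) : Set where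
    constructor ≈ₚ-intro
    field at : ∀ N → residue x N ≡ residue y N mod (p ℕ.^ N)

  open _≈ₚ_ public

  infixl 6 _+ₚ_
  infixl 7 _*ₚ_

  _+ₚ_ _*ₚ_ : ℤₚ → ℤₚ → ℤₚ
  x +ₚ y = (λ N → residue x N ℤ.+ residue y N) ,ₚ (λ N → mod-+ (coherent x N) (coherent y N))
  x *ₚ y = (λ N → residue x N ℤ.* residue y N) ,ₚ (λ N → mod-* (coherent x N) (coherent y N))

  -ₚ_ : ℤₚ → ℤₚ
  -ₚ x = (λ N → ℤ.- residue x N) ,ₚ (λ N → mod-neg (coherent x N))

  fromℤ : ℤ → ℤₚ
  fromℤ a = (λ _ → a) ,ₚ (λ _ → mod-refl)

  private
    pointwise : ∀ {x y} → (∀ N → residue x N ≡ residue y N) → x ≈ₚ y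
    pointwise f = ≈ₚ-intro (λ N → ≡⇒mod (f N))

  ℤₚ-commutativeRing : CommutativeRing 0ℓ 0ℓ
  ℤₚ-commutativeRing = record
    { Carrier = ℤₚ
    ; _≈_ = _≈ₚ_
    ; _+_ = _+ₚ_
    ; _*_ = _*ₚ_
    ; -_ = -ₚ_
    ; 0# = fromℤ 0ℤ
    ; 1# = fromℤ 1ℤ
    ; isCommutativeRing = record
      { isRing = record
        { +-isAbelianGroup = record
          { isGroup = record
            { isMonoid = record
              { isSemigroup = record
                { isMagma = record
                  { isEquivalence = record
                    { refl = ≈ₚ-intro (λ N → mod-refl)
                    ; sym = λ e → ≈ₚ-intro (λ N → mod-sym (at e N))
                    ; trans = λ e f → ≈ₚ-intro (λ N → mod-trans (at e N) (at f N))
                    }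
                  ; ∙-cong = λ e f → ≈ₚ-intro (λ N → mod-+ (at e N) (at f N))
                  }
                ; assoc = λ x y z → pointwise (λ N → ℤP.+-assoc (residue x N) (residue y N) (residue z N))
                }
              ; identity = (λ x → pointwise (λ N → ℤP.+-identityˡ (residue x N)))
                         , (λ x → pointwise (λ N → ℤP.+-identityʳ (residue x N)))
              }
            ; inverse = (λ x → pointwise (λ N → ℤP.+-inverseˡ (residue x N)))
                      , (λ x → pointwise (λ N → ℤP.+-inverseʳ (residue x N)))
            ; ⁻¹-cong = λ e → ≈ₚ-intro (λ N → mod-neg (at e N))
            }
          ; comm = λ x y → pointwise (λ N → ℤP.+-comm (residue x N) (residue y N))
          }
        ; *-cong = λ e f → ≈ₚ-intro (λ N → mod-* (at e N) (at f N))
        ; *-assoc = λ x y z → pointwise (λ N → ℤP.*-assoc (residue x N) (residue y N) (residue z N))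
        ; *-identity = (λ x → pointwise (λ N → ℤP.*-identityˡ (residue x N)))
                     , (λ x → pointwise (λ N → ℤP.*-identityʳ (residue x N)))
        ; distrib = (λ x y z → pointwise (λ N → ℤP.*-distribˡ-+ (residue x N) (residue y N) (residue z N)))
                  , (λ x y z → pointwise (λ N → ℤP.*-distribʳ-+ (residue x N) (residue y N) (residue z N)))
        }
      ; *-comm = λ x y → pointwise (λ N → ℤP.*-comm (residue x N) (residue y N))
      }
    }

  p^∣p^ : ∀ {N N′} → N ℕ.≤ N′ → p ℕ.^ N ℕD.∣ p ℕ.^ N′
  p^∣p^ {N} {N′} N≤N′ = ℕD.divides (p ℕ.^ (N′ ℕ.∸ N))
    (≡.trans (cong (p ℕ.^_) (≡.sym (ℕP.m∸n+n≡m N≤N′))) (ℕP.^-distribˡ-+-* p (N′ ℕ.∸ N) N))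

  coherent-≤ : ∀ x {N N′} → N ℕ.≤ N′ → residue x N′ ≡ residue x N mod (p ℕ.^ N)
  coherent-≤ x {N} N≤N′ = go (ℕP.≤⇒≤′ N≤N′)
    where
    go : ∀ {N′} → N ℕ.≤′ N′ → residue x N′ ≡ residue x N mod (p ℕ.^ N)
    go (ℕ.≤′-reflexive refl) = mod-refl
    go (ℕ.≤′-step N≤) = mod-trans (mod-∣ (p^∣p^ (ℕP.≤′⇒≤ N≤)) (coherent x _)) (go N≤)

  private
    inverse-mod-pℕ : ∀ n → ¬ (p ℕD.∣ n) → ∃ λ y → + n ℤ.* y ≡ 1ℤ mod p
    inverse-mod-pℕ n p∤n with Bézout.lemma n p
    ... | Bézout.result d g b with prime⇒irreducible p-prime (GCD.gcd∣n g)
    ...   | inj₂ refl = contradiction (GCD.gcd∣m g) p∤n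
    inverse-mod-pℕ n p∤n | Bézout.result .1 g (Bézout.+- x y eq) | inj₁ refl =
      + x , mod-intro (divides (+ y) (begin
        + n ℤ.* + x ℤ.- 1ℤ              ≡⟨ cong (ℤ._- 1ℤ) (ℤP.*-comm (+ n) (+ x)) ⟩
        + x ℤ.* + n ℤ.- 1ℤ              ≡⟨ cong (ℤ._- 1ℤ) (ℤP.pos-* x n) ⟨
        + (x ℕ.* n) ℤ.- 1ℤ              ≡⟨ cong (λ t → + t ℤ.- 1ℤ) eq ⟨
        (1ℤ ℤ.+ + (y ℕ.* p)) ℤ.- 1ℤ     ≡⟨ lem (+ (y ℕ.* p)) ⟩
        + (y ℕ.* p)                     ≡⟨ ℤP.pos-* y p ⟩
        + y ℤ.* + p                     ∎))
      where
      open ≡.≡-Reasoning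
      lem : ∀ T → (1ℤ ℤ.+ T) ℤ.- 1ℤ ≡ T
      lem = solve-∀
    inverse-mod-pℕ n p∤n | Bézout.result .1 g (Bézout.-+ x y eq) | inj₁ refl =
      ℤ.- (+ x) , mod-intro (divides (ℤ.- (+ y)) (begin
        + n ℤ.* (ℤ.- (+ x)) ℤ.- 1ℤ      ≡⟨ lem (+ n) (+ x) ⟩
        ℤ.- (1ℤ ℤ.+ + x ℤ.* + n)        ≡⟨ cong (λ t → ℤ.- (1ℤ ℤ.+ t)) (ℤP.pos-* x n) ⟨
        ℤ.- (+ (1 ℕ.+ x ℕ.* n))         ≡⟨ cong (λ t → ℤ.- (+ t)) eq ⟩
        ℤ.- (+ (y ℕ.* p))               ≡⟨ cong ℤ.-_ (ℤP.pos-* y p) ⟩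
        ℤ.- (+ y ℤ.* + p)               ≡⟨ ℤP.neg-distribˡ-* (+ y) (+ p) ⟩
        ℤ.- (+ y) ℤ.* + p               ∎))
      where
      open ≡.≡-Reasoning
      lem : ∀ A X → A ℤ.* (ℤ.- X) ℤ.- 1ℤ ≡ ℤ.- (1ℤ ℤ.+ X ℤ.* A)
      lem = solve-∀

  inverse-mod-p : ∀ a → ¬ (a ≡ 0ℤ mod p) → ∃ λ y → a ℤ.* y ≡ 1ℤ mod p
  inverse-mod-p (+ n) p∤a = inverse-mod-pℕ n
    (λ p∣n → p∤a (mod-intro (subst (+ p ℤD.∣_) (≡.sym (ℤP.+-identityʳ (+ n))) (ℤD.∣ᵤ⇒∣ p∣n))))
  inverse-mod-p -[1+ n ] p∤a with inverse-mod-pℕ (suc n)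
    (λ p∣n → p∤a (mod-intro (ℤD.∣ᵤ⇒∣ p∣n)))
  ... | y , ny = ℤ.- y , mod-trans (≡⇒mod (lem (+ suc n) y)) ny
    where
    lem : ∀ A Y → (ℤ.- A) ℤ.* (ℤ.- Y) ≡ A ℤ.* Y
    lem = solve-∀

  inverse-mod-p^ : ∀ a → ¬ (a ≡ 0ℤ mod p) → ∀ N → ∃ λ y → a ℤ.* y ≡ 1ℤ mod (p ℕ.^ N)
  inverse-mod-p^ a p∤a zero    = 0ℤ , mod-1
  inverse-mod-p^ a p∤a (suc N) with inverse-mod-p a p∤a | inverse-mod-p^ a p∤a N
  ... | y , mod-intro (divides q eq) | z , mod-intro (divides r eq′) =
    z ℤ.+ y ℤ.* (1ℤ ℤ.- a ℤ.* z) , mod-intro (divides (ℤ.- (q ℤ.* r)) (begin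
      a ℤ.* (z ℤ.+ y ℤ.* (1ℤ ℤ.- a ℤ.* z)) ℤ.- 1ℤ      ≡⟨ lem a y z ⟩
      ℤ.- ((a ℤ.* y ℤ.- 1ℤ) ℤ.* (a ℤ.* z ℤ.- 1ℤ))      ≡⟨ cong₂ (λ s t → ℤ.- (s ℤ.* t)) eq eq′ ⟩
      ℤ.- ((q ℤ.* + p) ℤ.* (r ℤ.* + (p ℕ.^ N)))        ≡⟨ lem′ q r (+ p) (+ (p ℕ.^ N)) ⟩
      ℤ.- (q ℤ.* r) ℤ.* (+ p ℤ.* + (p ℕ.^ N))          ≡⟨ cong (ℤ.- (q ℤ.* r) ℤ.*_) (ℤP.pos-* p (p ℕ.^ N)) ⟨
      ℤ.- (q ℤ.* r) ℤ.* + (p ℕ.^ suc N)                ∎))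
    where
    open ≡.≡-Reasoning
    lem : ∀ a y z → a ℤ.* (z ℤ.+ y ℤ.* (1ℤ ℤ.- a ℤ.* z)) ℤ.- 1ℤ ≡ ℤ.- ((a ℤ.* y ℤ.- 1ℤ) ℤ.* (a ℤ.* z ℤ.- 1ℤ))
    lem = solve-∀
    lem′ : ∀ q r P Q → ℤ.- ((q ℤ.* P) ℤ.* (r ℤ.* Q)) ≡ ℤ.- (q ℤ.* r) ℤ.* (P ℤ.* Q)
    lem′ = solve-∀

  p∣p^ : ∀ N → p ℕD.∣ p ℕ.^ suc N
  p∣p^ N = ℕD.m∣m*n (p ℕ.^ N)

  module _ (x : ℤₚ) (p∤x : ¬ (residue x 1 ≡ 0ℤ mod p)) where

    private
      residue-unit : ∀ N → ¬ (residue x (suc N) ≡ 0ℤ mod p)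
      residue-unit N e = p∤x (mod-trans
        (mod-sym (subst (residue x (suc N) ≡ residue x 1 mod_) (ℕP.^-identityʳ p) (coherent-≤ x (ℕ.s≤s ℕ.z≤n)))) e)

      inv : ∀ N → ∃ λ y → residue x N ℤ.* y ≡ 1ℤ mod (p ℕ.^ N)
      inv zero    = 0ℤ , mod-1
      inv (suc N) = inverse-mod-p^ (residue x (suc N)) (residue-unit N) (suc N)

    inverseₚ : ℤₚ
    inverseₚ = (λ N → proj₁ (inv N)) ,ₚ (λ N → inverse-unique {a = residue x N}
      (mod-trans (mod-*ʳ (proj₁ (inv (suc N))) (mod-sym (coherent x N)))
                 (mod-∣ (ℕD.n∣m*n p) (proj₂ (inv (suc N)))))
      (proj₂ (inv N)))

    inverseₚ-correct : x *ₚ inverseₚ ≈ₚ fromℤ 1ℤ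
    inverseₚ-correct = ≈ₚ-intro (λ N → proj₂ (inv N))

  p-regularₚ : ∀ x → fromℤ (+ p) *ₚ x ≈ₚ fromℤ 0ℤ → x ≈ₚ fromℤ 0ℤ
  p-regularₚ x px≈0 = ≈ₚ-intro (λ N → mod-trans (mod-sym (coherent x N)) (cancel (p ℕ.^ N) (residue x (suc N)) (at px≈0 (suc N))))
    where
    cancel : ∀ M a → + p ℤ.* a ≡ 0ℤ mod (p ℕ.* M) → a ≡ 0ℤ mod M
    cancel M a (mod-intro (divides t eq)) = mod-intro (divides t (≡.trans (ℤP.+-identityʳ a)
      (ℤP.*-cancelˡ-≡ (+ p) a (t ℤ.* + M) (begin
        + p ℤ.* a                ≡⟨ ℤP.+-identityʳ (+ p ℤ.* a) ⟨
        + p ℤ.* a ℤ.- 0ℤ         ≡⟨ eq ⟩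
        t ℤ.* + (p ℕ.* M)        ≡⟨ cong (t ℤ.*_) (ℤP.pos-* p M) ⟩
        t ℤ.* (+ p ℤ.* + M)      ≡⟨ lem t (+ p) (+ M) ⟩
        + p ℤ.* (t ℤ.* + M)      ∎))))
      where
      open ≡.≡-Reasoning
      lem : ∀ t P M → t ℤ.* (P ℤ.* M) ≡ P ℤ.* (t ℤ.* M)
      lem = solve-∀

private
  module _ {A : Set} where
    extract : {x : A} {xs : List A} → x ∈ xs → ∃ λ ys → xs ↭ x ∷ ys
    extract {x} x∈xs with ys , zs , refl ← ∈-∃++ x∈xs = ys ++ zs , shift x ys zs

    Unique-resp-↭ : {xs ys : List A} → xs ↭ ys → Unique xs → Unique ys
    Unique-resp-↭ ↭.refl u = u
    Unique-resp-↭ (↭.prep x σ) (x≢ ∷ u) = All-resp-↭ σ x≢ ∷ Unique-resp-↭ σ u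
    Unique-resp-↭ (↭.swap x y σ) ((x≢y ∷ x≢) ∷ (y≢ ∷ u)) =
      ((x≢y ∘ ≡.sym) ∷ All-resp-↭ σ y≢) ∷ (All-resp-↭ σ x≢ ∷ Unique-resp-↭ σ u)
    Unique-resp-↭ (↭.trans σ τ) u = Unique-resp-↭ τ (Unique-resp-↭ σ u)

    head∉ : {x : A} {xs : List A} → Unique (x ∷ xs) → x ∉ xs
    head∉ (x≢ ∷ _) x∈ = All.lookup x≢ x∈ refl

    ∈-tail : {x y : A} {xs : List A} → y ∈ x ∷ xs → y ≢ x → y ∈ xs
    ∈-tail (here y≡x) y≢x = contradiction y≡x y≢x
    ∈-tail (there y∈) _   = y∈

  pair-product : ∀ {M} .{{_ : NonZero M}} k xs → length xs ℕ.≤ k → Unique xs →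
    (∀ {x} → x ∈ xs → x ℕ.< M) →
    (∀ {x} → x ∈ xs → ∃ λ y → y ∈ xs × y ≢ x × + x ℤ.* + y ≡ 1ℤ mod M) →
    + product xs ≡ 1ℤ mod M
  pair-product k [] _ _ _ _ = mod-refl
  pair-product {M} (suc k) (x ∷ ys) (s≤s ≤k) u <M inv with inv (here refl)
  ... | y , y∈ , y≢x , xy with extract (∈-tail y∈ y≢x)
  ...   | zs , σ = mod-trans (≡⇒mod eq) (mod-* xy rec)
    where
    eq : + (x ℕ.* product ys) ≡ (+ x ℤ.* + y) ℤ.* + product zs
    eq = begin
      + (x ℕ.* product ys)              ≡⟨ cong (λ t → + (x ℕ.* t)) (product-↭ σ) ⟩
      + (x ℕ.* (y ℕ.* product zs))      ≡⟨ cong +_ (ℕP.*-assoc x y (product zs)) ⟨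
      + (x ℕ.* y ℕ.* product zs)        ≡⟨ ℤP.pos-* (x ℕ.* y) (product zs) ⟩
      + (x ℕ.* y) ℤ.* + product zs      ≡⟨ cong (ℤ._* + product zs) (ℤP.pos-* x y) ⟩
      (+ x ℤ.* + y) ℤ.* + product zs    ∎
      where open ≡.≡-Reasoning

    u-ys : Unique ys
    u-ys = AllPairs.tail u

    u-yzs : Unique (y ∷ zs)
    u-yzs = Unique-resp-↭ σ u-ys

    u-zs : Unique zs
    u-zs = AllPairs.tail u-yzs

    zs⊆ys : ∀ {z} → z ∈ zs → z ∈ ys
    zs⊆ys z∈ = ∈-resp-↭ (↭-sym σ) (there z∈)

    same : ∀ {a b c} → b ∈ x ∷ ys → c ∈ x ∷ ys →
           + a ℤ.* + b ≡ 1ℤ mod M → + a ℤ.* + c ≡ 1ℤ mod M → b ≡ c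
    same {a} b∈ c∈ ab ac = mod⇒≡ (<M b∈) (<M c∈) (inverse-unique {a = + a} ab ac)

    swap* : ∀ a b → + a ℤ.* + b ≡ 1ℤ mod M → + b ℤ.* + a ≡ 1ℤ mod M
    swap* a b = mod-trans (≡⇒mod (ℤP.*-comm (+ b) (+ a)))

    inv-zs : ∀ {z} → z ∈ zs → ∃ λ w → w ∈ zs × w ≢ z × + z ℤ.* + w ≡ 1ℤ mod M
    inv-zs {z} z∈ with inv (there (zs⊆ys z∈))
    ... | w , w∈ , w≢z , zw = w , ∈-tail (∈-resp-↭ σ (∈-tail w∈ w≢x)) w≢y , w≢z , zw
      where
      w≢x : w ≢ x
      w≢x refl = head∉ u-yzs (subst (_∈ zs) (same {x} (there (zs⊆ys z∈)) y∈ (swap* z x zw) xy) z∈)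
      w≢y : w ≢ y
      w≢y refl = head∉ u (subst (_∈ ys) (same {y} (there (zs⊆ys z∈)) (here refl) (swap* z y zw) (swap* x y xy)) (zs⊆ys z∈))

    rec : + product zs ≡ 1ℤ mod M
    rec = pair-product k zs
      (ℕP.≤-trans (ℕP.n≤1+n _) (ℕP.≤-trans (ℕP.≤-reflexive (≡.sym (↭-length σ))) ≤k))
      u-zs (λ z∈ → <M (there (zs⊆ys z∈))) inv-zs

module Gamma (p : ℕ) (p-prime : Prime p) (p-odd : p ≢ 2) where

  open Padic p p-prime

  p∤? : ∀ j → Dec (¬ p ℕD.∣ j)
  p∤? j = ¬? (p ℕD.∣? j)

  -- 0 is filtered out as well, since p ∣ 0.
  primeTo : ℕ → List ℕ
  primeTo n = filter p∤? (upTo n)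

  Γℕ : ℕ → ℤ
  Γℕ n = (-1ℤ ℤ.^ n) ℤ.* + product (primeTo n)

  private
    factor : ℕ → ℕ
    factor j = product (filter p∤? [ j ])

    product-suc : ∀ n → product (primeTo (suc n)) ≡ product (primeTo n) ℕ.* factor n
    product-suc n = begin
      product (primeTo (suc n))                    ≡⟨ cong (product ∘ filter p∤?) (upTo-∷ʳ n) ⟨
      product (filter p∤? (upTo n ∷ʳ n))             ≡⟨ cong product (filter-++ _ (upTo n) [ n ]) ⟩
      product (primeTo n ++ filter p∤? [ n ])        ≡⟨ product-++ (primeTo n) _ ⟩
      product (primeTo n) ℕ.* factor n             ∎
      where open ≡.≡-Reasoning

    factor-∣ : ∀ {j} → p ℕD.∣ j → factor j ≡ 1
    factor-∣ {j} p∣j with p ℕD.∣? j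
    ... | yes _   = refl
    ... | no p∤j = contradiction p∣j p∤j

    factor-∤ : ∀ {j} → ¬ p ℕD.∣ j → factor j ≡ j
    factor-∤ {j} p∤j with p ℕD.∣? j
    ... | yes p∣j = contradiction p∣j p∤j
    ... | no _    = ℕP.*-identityʳ j

    ℕ-mod-+ : ∀ M v → + (M ℕ.+ v) ≡ + v mod M
    ℕ-mod-+ M v = mod-intro (divides 1ℤ (≡.trans (cong (ℤ._- + v) (ℤP.pos-+ M v)) (lem (+ M) (+ v))))
      where
      lem : ∀ M v → (M ℤ.+ v) ℤ.- v ≡ 1ℤ ℤ.* M
      lem = solve-∀

    factor-+ : ∀ {M} → p ℕD.∣ M → ∀ v → + factor (M ℕ.+ v) ≡ + factor v mod M
    factor-+ {M} p∣M v with p ℕD.∣? v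
    ... | yes p∣v = ≡⇒mod (cong +_ (factor-∣ (ℕD.∣m∣n⇒∣m+n p∣M p∣v)))
    ... | no  p∤v = mod-trans (≡⇒mod (cong +_ (factor-∤ (λ p∣ → p∤v (ℕD.∣m+n∣m⇒∣n p∣ p∣M)))))
                     (mod-trans (ℕ-mod-+ M v) (≡⇒mod (cong +_ (≡.sym (ℕP.*-identityʳ v)))))

    product-+ : ∀ {M} → p ℕD.∣ M → ∀ v →
      + product (primeTo (M ℕ.+ v)) ≡ + product (primeTo M) ℤ.* + product (primeTo v) mod M
    product-+ {M} p∣M zero = ≡⇒mod (≡.trans (cong (λ t → + product (primeTo t)) (ℕP.+-identityʳ M))
                                     (≡.sym (ℤP.*-identityʳ _)))
    product-+ {M} p∣M (suc v) = mod-trans (≡⇒mod eq₁)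
      (mod-trans (mod-* (product-+ p∣M v) (factor-+ p∣M v)) (≡⇒mod eq₂))
      where
      open ≡.≡-Reasoning
      P = product ∘ primeTo
      eq₁ : + P (M ℕ.+ suc v) ≡ + P (M ℕ.+ v) ℤ.* + factor (M ℕ.+ v)
      eq₁ = begin
        + P (M ℕ.+ suc v)                       ≡⟨ cong (+_ ∘ P) (ℕP.+-suc M v) ⟩
        + P (suc (M ℕ.+ v))                     ≡⟨ cong +_ (product-suc (M ℕ.+ v)) ⟩
        + (P (M ℕ.+ v) ℕ.* factor (M ℕ.+ v))    ≡⟨ ℤP.pos-* (P (M ℕ.+ v)) _ ⟩
        + P (M ℕ.+ v) ℤ.* + factor (M ℕ.+ v)    ∎
      eq₂ : (+ P M ℤ.* + P v) ℤ.* + factor v ≡ + P M ℤ.* + P (suc v)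
      eq₂ = begin
        (+ P M ℤ.* + P v) ℤ.* + factor v        ≡⟨ ℤP.*-assoc (+ P M) (+ P v) (+ factor v) ⟩
        + P M ℤ.* (+ P v ℤ.* + factor v)        ≡⟨ cong (+ P M ℤ.*_) (ℤP.pos-* (P v) (factor v)) ⟨
        + P M ℤ.* + (P v ℕ.* factor v)          ≡⟨ cong (λ t → + P M ℤ.* + t) (product-suc v) ⟨
        + P M ℤ.* + P (suc v)                   ∎

    2<p : 2 ℕ.< p
    2<p = ℕP.≤∧≢⇒< (ℕ.nonTrivial⇒n>1 p {{prime⇒nonTrivial p-prime}}) (p-odd ∘ ≡.sym)

    p∤2 : ¬ p ℕD.∣ 2
    p∤2 p∣2 = ℕP.<⇒≱ 2<p (ℕD.∣⇒≤ p∣2)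

    p∤1 : ¬ p ℕD.∣ 1
    p∤1 p∣1 = p∤2 (ℕD.∣-trans p∣1 (ℕD.1∣ 2))

    module Wilson (M : ℕ) .{{_ : NonZero M}} (p∣M : p ℕD.∣ M)
      (inverse-mod-M : ∀ a → ¬ (a ≡ 0ℤ mod p) → ∃ λ y → a ℤ.* y ≡ 1ℤ mod M) where

      2<M : 2 ℕ.< M
      2<M = ℕP.<-≤-trans 2<p (ℕD.∣⇒≤ p∣M)

      cancel-unit : ∀ a b → ¬ (a ≡ 0ℤ mod p) → a ℤ.* b ≡ 0ℤ mod M → b ≡ 0ℤ mod M
      cancel-unit a b p∤a ab with inverse-mod-M a p∤a
      ... | y , ay = mod-trans (≡⇒mod (≡.sym (ℤP.*-identityˡ b)))
            (mod-trans (mod-*ʳ b (mod-sym ay))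
            (mod-trans (≡⇒mod (lem a y b))
            (mod-trans (mod-*ˡ y ab) (≡⇒mod (ℤP.*-zeroʳ y)))))
        where
        lem : ∀ a y b → (a ℤ.* y) ℤ.* b ≡ y ℤ.* (a ℤ.* b)
        lem = solve-∀

      sqrt-1 : ∀ x → x ℤ.* x ≡ 1ℤ mod M → x ≡ 1ℤ mod M ⊎ x ≡ -1ℤ mod M
      sqrt-1 x xx with ℤU-dec (x ℤ.- 1ℤ)
        where
        ℤU-dec : ∀ a → (a ≡ 0ℤ mod p) ⊎ ¬ (a ≡ 0ℤ mod p)
        ℤU-dec a with + p ℤD.∣? (a ℤ.- 0ℤ)
        ... | yes d = inj₁ (mod-intro d)
        ... | no ¬d = inj₂ (λ { (mod-intro d) → ¬d d })
      ... | inj₂ p∤x-1 = inj₂ (mod-trans (≡⇒mod (lem x)) (mod-+ (cancel-unit (x ℤ.- 1ℤ) (x ℤ.+ 1ℤ) p∤x-1 eq) (mod-refl {a = -1ℤ})))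
        where
        lem : ∀ x → x ≡ (x ℤ.+ 1ℤ) ℤ.+ -1ℤ
        lem = solve-∀
        lem′ : ∀ x → (x ℤ.- 1ℤ) ℤ.* (x ℤ.+ 1ℤ) ≡ x ℤ.* x ℤ.+ -1ℤ
        lem′ = solve-∀
        eq : (x ℤ.- 1ℤ) ℤ.* (x ℤ.+ 1ℤ) ≡ 0ℤ mod M
        eq = mod-trans (≡⇒mod (lem′ x)) (mod-+ xx (mod-refl {a = -1ℤ}))
      ... | inj₁ p∣x-1 = inj₁ (mod-trans (≡⇒mod (lem x)) (mod-+ (cancel-unit (x ℤ.+ 1ℤ) (x ℤ.- 1ℤ) p∤x+1 eq) (mod-refl {a = 1ℤ})))
        where
        lem : ∀ x → x ≡ (x ℤ.- 1ℤ) ℤ.+ 1ℤ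
        lem = solve-∀
        lem′ : ∀ x → (x ℤ.+ 1ℤ) ℤ.* (x ℤ.- 1ℤ) ≡ x ℤ.* x ℤ.+ -1ℤ
        lem′ = solve-∀
        lem″ : ∀ x → + 2 ≡ (x ℤ.+ 1ℤ) ℤ.+ (ℤ.- (x ℤ.- 1ℤ))
        lem″ = solve-∀
        eq : (x ℤ.+ 1ℤ) ℤ.* (x ℤ.- 1ℤ) ≡ 0ℤ mod M
        eq = mod-trans (≡⇒mod (lem′ x)) (mod-+ xx (mod-refl {a = -1ℤ}))
        p∤x+1 : ¬ (x ℤ.+ 1ℤ ≡ 0ℤ mod p)
        p∤x+1 e = p∤2 (mod⇒∣ (mod-trans (≡⇒mod (lem″ x)) (mod-+ e (mod-neg p∣x-1))))

      units : List ℕ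
      units = primeTo M

      ∈units⇒ : ∀ {x} → x ∈ units → x ℕ.< M × ¬ p ℕD.∣ x
      ∈units⇒ x∈ with x∈upTo , p∤x ← ∈-filter⁻ p∤? x∈ = ∈-upTo⁻ x∈upTo , p∤x

      ⇒∈units : ∀ {x} → x ℕ.< M → ¬ p ℕD.∣ x → x ∈ units
      ⇒∈units x<M p∤x = ∈-filter⁺ p∤? (∈-upTo⁺ x<M) p∤x

      M-1 : ℕ
      M-1 = M ℕ.∸ 1

      1+M-1 : suc M-1 ≡ M
      1+M-1 = ℕP.m+[n∸m]≡n {1} {M} (ℕP.<⇒≤ (ℕP.<-trans ℕP.≤-refl 2<M))

      M-1<M : M-1 ℕ.< M
      M-1<M = ℕP.≤-reflexive 1+M-1

      M-1≡-1 : + M-1 ≡ -1ℤ mod M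
      M-1≡-1 = mod-intro (divides 1ℤ (≡.trans (cong +_ (≡.trans (ℕP.+-comm M-1 1) 1+M-1)) (≡.sym (ℤP.*-identityˡ (+ M)))))

      M-1≢1 : M-1 ≢ 1
      M-1≢1 e = ℕP.<-irrefl refl (subst (2 ℕ.<_) (≡.trans (≡.sym 1+M-1) (cong suc e)) 2<M)

      1∈units : 1 ∈ units
      1∈units = ⇒∈units (ℕP.<-trans ℕP.≤-refl 2<M) p∤1

      M-1∈units : M-1 ∈ units
      M-1∈units = ⇒∈units M-1<M (λ p∣ → p∤1 (ℕD.∣m+n∣m⇒∣n
        (subst (p ℕD.∣_) (≡.trans (≡.sym 1+M-1) (ℕP.+-comm 1 M-1)) p∣M) p∣))

      unique-units : Unique units
      unique-units = Unique.filter⁺ p∤? (Unique.upTo⁺ M)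

      inverse-unit : ∀ {x} → ¬ p ℕD.∣ x → ∃ λ y → y ∈ units × + x ℤ.* + y ≡ 1ℤ mod M
      inverse-unit {x} p∤x = y %ℕ M , ⇒∈units (n%ℕd<d y M) p∤ , eq
        where
        y : ℤ
        y = proj₁ (inverse-mod-M (+ x) (λ e → p∤x (mod⇒∣ e)))
        xy : + x ℤ.* y ≡ 1ℤ mod M
        xy = proj₂ (inverse-mod-M (+ x) (λ e → p∤x (mod⇒∣ e)))
        eq : + x ℤ.* + (y %ℕ M) ≡ 1ℤ mod M
        eq = mod-trans (mod-*ˡ (+ x) (%ℕ-mod y)) xy
        p∤ : ¬ p ℕD.∣ y %ℕ M
        p∤ p∣ = p∤1 (mod⇒∣ (mod-trans (mod-sym (mod-∣ p∣M eq))
                  (mod-trans (mod-*ˡ (+ x) (∣⇒mod p∣)) (≡⇒mod (ℤP.*-zeroʳ (+ x))))))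

      wilson : + product units ≡ -1ℤ mod M
      wilson with extract 1∈units
      ... | us , σ with extract (∈-tail (∈-resp-↭ σ M-1∈units) M-1≢1)
      ...   | vs , τ = mod-trans (≡⇒mod eq) (mod-* M-1≡-1 rest)
        where
        eq : + product units ≡ + M-1 ℤ.* + product vs
        eq = ≡.trans (cong +_ (≡.trans (product-↭ σ) (≡.trans (ℕP.*-identityˡ (product us)) (product-↭ τ))))
                     (ℤP.pos-* M-1 (product vs))

        u-1us : Unique (1 ∷ us)
        u-1us = Unique-resp-↭ σ unique-units

        u-us : Unique us
        u-us = AllPairs.tail u-1us

        u-Mvs : Unique (M-1 ∷ vs)
        u-Mvs = Unique-resp-↭ τ u-us

        u-vs : Unique vs
        u-vs = AllPairs.tail u-Mvs

        vs⇒us : ∀ {z} → z ∈ vs → z ∈ us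
        vs⇒us z∈ = ∈-resp-↭ (↭-sym τ) (there z∈)

        vs⇒units : ∀ {z} → z ∈ vs → z ∈ units
        vs⇒units z∈ = ∈-resp-↭ (↭-sym σ) (there (vs⇒us z∈))

        vs≢1 : ∀ {z} → z ∈ vs → z ≢ 1
        vs≢1 z∈ refl = head∉ u-1us (vs⇒us z∈)

        vs≢M-1 : ∀ {z} → z ∈ vs → z ≢ M-1
        vs≢M-1 z∈ refl = head∉ u-Mvs z∈

        ⇒vs : ∀ {z} → z ∈ units → z ≢ 1 → z ≢ M-1 → z ∈ vs
        ⇒vs z∈ z≢1 z≢M-1 = ∈-tail (∈-resp-↭ τ (∈-tail (∈-resp-↭ σ z∈) z≢1)) z≢M-1

        vs<M : ∀ {z} → z ∈ vs → z ℕ.< M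
        vs<M z∈ = proj₁ (∈units⇒ (vs⇒units z∈))

        1<M : 1 ℕ.< M
        1<M = proj₁ (∈units⇒ 1∈units)

        module _ {x} (x∈ : x ∈ vs) where

          x∈units : x ∈ units
          x∈units = vs⇒units x∈

          inverse-x : ∃ λ y → y ∈ units × + x ℤ.* + y ≡ 1ℤ mod M
          inverse-x = inverse-unit (proj₂ (∈units⇒ x∈units))

          y : ℕ
          y = proj₁ inverse-x

          xy : + x ℤ.* + y ≡ 1ℤ mod M
          xy = proj₂ (proj₂ inverse-x)

          y≢1 : y ≢ 1
          y≢1 e = vs≢1 x∈ (mod⇒≡ (vs<M x∈) 1<M (mod-trans (≡⇒mod (≡.sym (ℤP.*-identityʳ (+ x))))
            (subst (λ t → + x ℤ.* + t ≡ 1ℤ mod M) e xy)))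

          y≢M-1 : y ≢ M-1
          y≢M-1 e = vs≢M-1 x∈ (mod⇒≡ (vs<M x∈) M-1<M
            (mod-trans (≡⇒mod (lem (+ x))) (mod-trans (mod-neg x*-1) (mod-sym M-1≡-1))))
            where
            lem : ∀ x → x ≡ ℤ.- (x ℤ.* -1ℤ)
            lem = solve-∀
            x*-1 : + x ℤ.* -1ℤ ≡ 1ℤ mod M
            x*-1 = mod-trans (mod-*ˡ (+ x) (mod-sym M-1≡-1)) (subst (λ t → + x ℤ.* + t ≡ 1ℤ mod M) e xy)

          y≢x : y ≢ x
          y≢x e = [ (λ e₁ → vs≢1 x∈ (mod⇒≡ (vs<M x∈) 1<M e₁))
                  , (λ e₂ → vs≢M-1 x∈ (mod⇒≡ (vs<M x∈) M-1<M (mod-trans e₂ (mod-sym M-1≡-1))))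
                  ]′ (sqrt-1 (+ x) (subst (λ t → + x ℤ.* + t ≡ 1ℤ mod M) e xy))

          inv-vs : ∃ λ y → y ∈ vs × y ≢ x × + x ℤ.* + y ≡ 1ℤ mod M
          inv-vs = y , ⇒vs (proj₁ (proj₂ inverse-x)) y≢1 y≢M-1 , y≢x , xy

        rest : + product vs ≡ 1ℤ mod M
        rest = pair-product (length vs) vs ℕP.≤-refl u-vs vs<M inv-vs

    wilson : ∀ N → + product (primeTo (p ℕ.^ suc N)) ≡ -1ℤ mod (p ℕ.^ suc N)
    wilson N = Wilson.wilson (p ℕ.^ suc N) {{p^≢0 (suc N)}} (p∣p^ N) (λ a p∤a → inverse-mod-p^ a p∤a (suc N))

    -1^p : -1ℤ ℤ.^ p ≡ -1ℤ
    -1^p = begin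
      -1ℤ ℤ.^ p                               ≡⟨ cong (-1ℤ ℤ.^_) p≡1+2k ⟩
      -1ℤ ℤ.* (-1ℤ ℤ.^ (2 ℕ.* (p ℕM./ 2)))    ≡⟨ cong (-1ℤ ℤ.*_) (ℤP.^-*-assoc -1ℤ 2 (p ℕM./ 2)) ⟨
      -1ℤ ℤ.* (1ℤ ℤ.^ (p ℕM./ 2))             ≡⟨ cong (-1ℤ ℤ.*_) (ℤP.^-zeroˡ (p ℕM./ 2)) ⟩
      -1ℤ                                     ∎
      where
      open ≡.≡-Reasoning
      p%2≢0 : p ℕM.% 2 ≢ 0
      p%2≢0 e with prime⇒irreducible p-prime (ℕD.m%n≡0⇒n∣m p 2 e)
      ... | inj₂ 2≡p = p-odd (≡.sym 2≡p)
      p%2≡1 : p ℕM.% 2 ≡ 1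
      p%2≡1 with p ℕM.% 2 | ℕM.m%n<n p 2 | p%2≢0
      ... | 0 | _ | ≢0 = contradiction refl ≢0
      ... | 1 | _ | _  = refl
      ... | suc (suc _) | s≤s (s≤s ()) | _
      p≡1+2k : p ≡ suc (2 ℕ.* (p ℕM./ 2))
      p≡1+2k = ≡.trans (ℕM.m≡m%n+[m/n]*n p 2) (cong₂ ℕ._+_ p%2≡1 (ℕP.*-comm (p ℕM./ 2) 2))

    -1^p^ : ∀ N → -1ℤ ℤ.^ (p ℕ.^ N) ≡ -1ℤ
    -1^p^ zero    = refl
    -1^p^ (suc N) = ≡.trans (≡.sym (ℤP.^-*-assoc -1ℤ p (p ℕ.^ N))) (≡.trans (cong (ℤ._^ (p ℕ.^ N)) -1^p) (-1^p^ N))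

    Γℕ-shift : ∀ N v → Γℕ (p ℕ.^ N ℕ.+ v) ≡ Γℕ v mod (p ℕ.^ N)
    Γℕ-shift zero    v = mod-1
    Γℕ-shift (suc N) v = mod-trans (mod-* (≡⇒mod sign) (mod-trans (product-+ (p∣p^ N) v) (mod-*ʳ (+ product (primeTo v)) (wilson N))))
                                    (≡⇒mod (lem (-1ℤ ℤ.^ v) (+ product (primeTo v))))
      where
      sign : -1ℤ ℤ.^ (p ℕ.^ suc N ℕ.+ v) ≡ -1ℤ ℤ.* (-1ℤ ℤ.^ v)
      sign = ≡.trans (ℤP.^-distribˡ-+-* -1ℤ (p ℕ.^ suc N) v) (cong (ℤ._* (-1ℤ ℤ.^ v)) (-1^p^ (suc N)))
      lem : ∀ s P → (-1ℤ ℤ.* s) ℤ.* (-1ℤ ℤ.* P) ≡ s ℤ.* P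
      lem = solve-∀

  module _ (N : ℕ) where

    private
      q = p ℕ.^ N
      instance
        q≢0 : NonZero q
        q≢0 = p^≢0 N

      Γℕ-shift* : ∀ t v → Γℕ (t ℕ.* q ℕ.+ v) ≡ Γℕ v mod q
      Γℕ-shift* zero    v = mod-refl
      Γℕ-shift* (suc t) v = mod-trans (≡⇒mod (cong Γℕ (ℕP.+-assoc q (t ℕ.* q) v)))
                               (mod-trans (Γℕ-shift N (t ℕ.* q ℕ.+ v)) (Γℕ-shift* t v))

      Γℕ-% : ∀ u → Γℕ u ≡ Γℕ (u ℕM.% q) mod q
      Γℕ-% u = mod-trans (≡⇒mod (cong Γℕ (≡.trans (ℕM.m≡m%n+[m/n]*n u q) (ℕP.+-comm (u ℕM.% q) _))))
                           (Γℕ-shift* (u ℕM./ q) (u ℕM.% q))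

    -- By Wilson's theorem modulo pᴺ, which needs p odd.
    Γℕ-cong : ∀ {u v} → + u ≡ + v mod q → Γℕ u ≡ Γℕ v mod q
    Γℕ-cong {u} {v} e = mod-trans (Γℕ-% u) (mod-trans (≡⇒mod (cong Γℕ same)) (mod-sym (Γℕ-% v)))
      where
      same : u ℕM.% q ≡ v ℕM.% q
      same = mod⇒≡ (ℕM.m%n<n u q) (ℕM.m%n<n v q) (mod-trans (%ℕ-mod (+ u)) (mod-trans e (mod-sym (%ℕ-mod (+ v)))))

  remainder : ℤₚ → ℕ → ℕ
  remainder x N = _%ℕ_ (residue x N) (p ℕ.^ N) {{p^≢0 N}}

  remainder-mod : ∀ x N → + remainder x N ≡ residue x N mod (p ℕ.^ N)
  remainder-mod x N = %ℕ-mod {{p^≢0 N}} (residue x N)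

  Γₚ : ℤₚ → ℤₚ
  Γₚ x = (λ N → Γℕ (remainder x N)) ,ₚ (λ N → Γℕ-cong N
      (mod-trans (mod-∣ (ℕD.n∣m*n p) (remainder-mod x (suc N)))
      (mod-trans (coherent x N) (mod-sym (remainder-mod x N)))))

  -- Γₚ-ℕ and Γₚ-continuous characterise Γₚ; Γₚ(0) = 1 is the case n = 0 (empty product).
  Γₚ-ℕ : ∀ n → Γₚ (fromℤ (+ n)) ≈ₚ fromℤ (Γℕ n)
  Γₚ-ℕ n = ≈ₚ-intro (λ N → Γℕ-cong N (remainder-mod (fromℤ (+ n)) N))

  Γₚ-continuous : ∀ x y N → residue x N ≡ residue y N mod (p ℕ.^ N) →
                  residue (Γₚ x) N ≡ residue (Γₚ y) N mod (p ℕ.^ N)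
  Γₚ-continuous x y N e = Γℕ-cong N (mod-trans (remainder-mod x N) (mod-trans e (mod-sym (remainder-mod y N))))

  private
    product-unit : ∀ n → ¬ p ℕD.∣ product (primeTo n)
    product-unit n = go (primeTo n) (All.all-filter p∤? (upTo n))
      where
      go : ∀ xs → All (λ j → ¬ p ℕD.∣ j) xs → ¬ p ℕD.∣ product xs
      go [] [] p∣1 = p∤1 p∣1
      go (x ∷ xs) (p∤x ∷ p∤xs) p∣ with euclidsLemma x (product xs) p-prime p∣
      ... | inj₁ p∣x  = p∤x p∣x
      ... | inj₂ p∣xs = go xs p∤xs p∣xs

    -1^n-∣ : ∀ n a → -1ℤ ℤ.^ n ℤ.* a ≡ 0ℤ mod p → a ≡ 0ℤ mod p
    -1^n-∣ zero    a e = mod-trans (≡⇒mod (≡.sym (ℤP.*-identityˡ a))) e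
    -1^n-∣ (suc n) a e = -1^n-∣ n a (mod-trans (≡⇒mod (lem (-1ℤ ℤ.^ n) a)) (mod-neg e))
      where
      lem : ∀ s a → s ℤ.* a ≡ ℤ.- ((-1ℤ ℤ.* s) ℤ.* a)
      lem = solve-∀

  private
    Γℕ-unit : ∀ n → ¬ (Γℕ n ≡ 0ℤ mod p)
    Γℕ-unit n e = product-unit n (mod⇒∣ (-1^n-∣ n (+ product (primeTo n)) e))

  Γₚ-unit : ∀ x → ¬ (residue (Γₚ x) 1 ≡ 0ℤ mod p)
  Γₚ-unit x = Γℕ-unit (remainder x 1)

-- Denominators are the non-zero-divisors, so this is the field of fractions when R is a domain.
module Fractions {c ℓ} (R : CommutativeRing c ℓ) where

  open CommutativeRing R
  open Algebra.Properties.Ring ring using (-‿distribˡ-*)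
  open Algebra.Solver.Ring.NaturalCoefficients.Default commutativeSemiring
    using (solve; _:=_; _:+_; _:*_; con)

  Regular : Carrier → Set (c ⊔ ℓ)
  Regular d = ∀ x → d * x ≈ 0# → x ≈ 0#

  regular-1 : Regular 1#
  regular-1 x e = trans (sym (*-identityˡ x)) e

  regular-* : ∀ {d e} → Regular d → Regular e → Regular (d * e)
  regular-* {d} {e} rd re x h = re x (rd (e * x) (trans (sym (*-assoc d e x)) h))

  regular-cancel : ∀ {d x y} → Regular d → d * x ≈ d * y → x ≈ y
  regular-cancel {d} {x} {y} rd e = trans (sym (+-identityʳ x)) (trans (+-congˡ (sym (-‿inverseˡ y)))
      (trans (sym (+-assoc x (- y) y)) (trans (+-congʳ (rd (x - y) d[x-y]≈0)) (+-identityˡ y))))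
    where
    d[x-y]≈0 : d * (x - y) ≈ 0#
    d[x-y]≈0 = trans (distribˡ d x (- y)) (trans (+-congʳ e) (trans (sym (distribˡ d y (- y)))
      (trans (*-congˡ (-‿inverseʳ y)) (zeroʳ d))))

  record Fraction : Set (c ⊔ ℓ) where
    constructor fraction
    field
      numerator   : Carrier
      denominator : Carrier
      regular     : Regular denominator

  open Fraction public

  infix 4 _≈ᶠ_

  record _≈ᶠ_ (x y : Fraction) : Set ℓ where
    constructor ≈ᶠ-intro
    field cross : numerator x * denominator y ≈ numerator y * denominator x

  open _≈ᶠ_ public

  infixl 6 _+ᶠ_
  infixl 7 _*ᶠ_

  _+ᶠ_ _*ᶠ_ : Fraction → Fraction → Fraction
  fraction a d rd +ᶠ fraction b e re = fraction (a * e + b * d) (d * e) (regular-* rd re)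
  fraction a d rd *ᶠ fraction b e re = fraction (a * b) (d * e) (regular-* rd re)

  -ᶠ_ : Fraction → Fraction
  -ᶠ fraction a d rd = fraction (- a) d rd

  embed : Carrier → Fraction
  embed a = fraction a 1# regular-1

  private
    ≈ᶠ-trans : ∀ {x y z} → x ≈ᶠ y → y ≈ᶠ z → x ≈ᶠ z
    ≈ᶠ-trans {fraction a d _} {fraction b e re} {fraction c f _} (≈ᶠ-intro p) (≈ᶠ-intro q) =
      ≈ᶠ-intro (regular-cancel re (trans
        (solve 3 (λ a e f → e :* (a :* f) := (a :* e) :* f) ≈-refl a e f)
        (trans (*-congʳ p) (trans
        (solve 3 (λ b d f → (b :* d) :* f := (b :* f) :* d) ≈-refl b d f)
        (trans (*-congʳ q)
        (solve 3 (λ c e d → (c :* e) :* d := e :* (c :* d)) ≈-refl c e d))))))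
      where
      ≈-refl : ∀ {x} → x ≈ x
      ≈-refl = CommutativeRing.refl R

    +ᶠ-cong : ∀ {x x′ y y′} → x ≈ᶠ x′ → y ≈ᶠ y′ → x +ᶠ y ≈ᶠ x′ +ᶠ y′
    +ᶠ-cong {fraction a d _} {fraction a′ d′ _} {fraction b e _} {fraction b′ e′ _} (≈ᶠ-intro p) (≈ᶠ-intro q) =
      ≈ᶠ-intro (trans
        (solve 6 (λ a d d′ b e e′ → (a :* e :+ b :* d) :* (d′ :* e′) := (a :* d′) :* (e :* e′) :+ (b :* e′) :* (d :* d′))
          (CommutativeRing.refl R) a d d′ b e e′)
        (trans (+-cong (*-congʳ p) (*-congʳ q))
        (solve 6 (λ a′ d d′ b′ e e′ → (a′ :* d) :* (e :* e′) :+ (b′ :* e) :* (d :* d′) := (a′ :* e′ :+ b′ :* d′) :* (d :* e))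
          (CommutativeRing.refl R) a′ d d′ b′ e e′)))

    *ᶠ-cong : ∀ {x x′ y y′} → x ≈ᶠ x′ → y ≈ᶠ y′ → x *ᶠ y ≈ᶠ x′ *ᶠ y′
    *ᶠ-cong {fraction a d _} {fraction a′ d′ _} {fraction b e _} {fraction b′ e′ _} (≈ᶠ-intro p) (≈ᶠ-intro q) =
      ≈ᶠ-intro (trans
        (solve 4 (λ a b d′ e′ → (a :* b) :* (d′ :* e′) := (a :* d′) :* (b :* e′)) (CommutativeRing.refl R) a b d′ e′)
        (trans (*-cong p q)
        (solve 4 (λ a′ b′ d e → (a′ :* d) :* (b′ :* e) := (a′ :* b′) :* (d :* e)) (CommutativeRing.refl R) a′ b′ d e)))

    -ᶠ-cong : ∀ {x y} → x ≈ᶠ y → -ᶠ x ≈ᶠ -ᶠ y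
    -ᶠ-cong {fraction a d _} {fraction b e _} (≈ᶠ-intro p) =
      ≈ᶠ-intro (trans (sym (-‿distribˡ-* a e)) (trans (-‿cong p) (-‿distribˡ-* b d)))

    +ᶠ-comm : ∀ x y → x +ᶠ y ≈ᶠ y +ᶠ x
    +ᶠ-comm (fraction a d _) (fraction b e _) = ≈ᶠ-intro
      (solve 4 (λ a b d e → (a :* e :+ b :* d) :* (e :* d) := (b :* d :+ a :* e) :* (d :* e)) (CommutativeRing.refl R) a b d e)

    +ᶠ-identityˡ : ∀ x → embed 0# +ᶠ x ≈ᶠ x
    +ᶠ-identityˡ (fraction a d _) = ≈ᶠ-intro
      (solve 2 (λ a d → (con 0 :* d :+ a :* con 1) :* d := a :* (con 1 :* d)) (CommutativeRing.refl R) a d)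

    +ᶠ-inverseˡ : ∀ x → -ᶠ x +ᶠ x ≈ᶠ embed 0#
    +ᶠ-inverseˡ (fraction a d _) = ≈ᶠ-intro (trans (*-identityʳ _)
      (trans (sym (distribʳ d (- a) a)) (trans (*-congʳ (-‿inverseˡ a)) (trans (zeroˡ d) (sym (zeroˡ (d * d)))))))

    *ᶠ-comm : ∀ x y → x *ᶠ y ≈ᶠ y *ᶠ x
    *ᶠ-comm (fraction a d _) (fraction b e _) = ≈ᶠ-intro
      (solve 4 (λ a b d e → (a :* b) :* (e :* d) := (b :* a) :* (d :* e)) (CommutativeRing.refl R) a b d e)

    *ᶠ-identityˡ : ∀ x → embed 1# *ᶠ x ≈ᶠ x
    *ᶠ-identityˡ (fraction a d _) = ≈ᶠ-intro
      (solve 2 (λ a d → (con 1 :* a) :* d := a :* (con 1 :* d)) (CommutativeRing.refl R) a d)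

    *ᶠ-distribˡ : ∀ x y z → x *ᶠ (y +ᶠ z) ≈ᶠ x *ᶠ y +ᶠ x *ᶠ z
    *ᶠ-distribˡ (fraction a d _) (fraction b e _) (fraction c f _) = ≈ᶠ-intro
      (solve 6 (λ a b c d e f → (a :* (b :* f :+ c :* e)) :* ((d :* e) :* (d :* f))
                             := ((a :* b) :* (d :* f) :+ (a :* c) :* (d :* e)) :* (d :* (e :* f)))
        (CommutativeRing.refl R) a b c d e f)

  commutativeRing : CommutativeRing (c ⊔ ℓ) ℓ
  commutativeRing = record
    { Carrier = Fraction
    ; _≈_ = _≈ᶠ_
    ; _+_ = _+ᶠ_
    ; _*_ = _*ᶠ_
    ; -_ = -ᶠ_
    ; 0# = embed 0#
    ; 1# = embed 1#
    ; isCommutativeRing = record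
      { isRing = record
        { +-isAbelianGroup = record
          { isGroup = record
            { isMonoid = record
              { isSemigroup = record
                { isMagma = record
                  { isEquivalence = record
                    { refl = ≈ᶠ-intro (CommutativeRing.refl R)
                    ; sym = λ e → ≈ᶠ-intro (sym (cross e))
                    ; trans = ≈ᶠ-trans
                    }
                  ; ∙-cong = +ᶠ-cong
                  }
                ; assoc = λ { (fraction a d _) (fraction b e _) (fraction c f _) → ≈ᶠ-intro
                    (solve 6 (λ a b c d e f → ((a :* e :+ b :* d) :* f :+ c :* (d :* e)) :* (d :* (e :* f))
                                           := (a :* (e :* f) :+ (b :* f :+ c :* e) :* d) :* ((d :* e) :* f))
                      (CommutativeRing.refl R) a b c d e f) }
                }
              ; identity = +ᶠ-identityˡ , λ x → ≈ᶠ-trans (+ᶠ-comm x (embed 0#)) (+ᶠ-identityˡ x)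
              }
            ; inverse = +ᶠ-inverseˡ , λ x → ≈ᶠ-trans (+ᶠ-comm x (-ᶠ x)) (+ᶠ-inverseˡ x)
            ; ⁻¹-cong = -ᶠ-cong
            }
          ; comm = +ᶠ-comm
          }
        ; *-cong = *ᶠ-cong
        ; *-assoc = λ { (fraction a d _) (fraction b e _) (fraction c f _) → ≈ᶠ-intro
            (solve 6 (λ a b c d e f → ((a :* b) :* c) :* (d :* (e :* f)) := (a :* (b :* c)) :* ((d :* e) :* f))
              (CommutativeRing.refl R) a b c d e f) }
        ; *-identity = *ᶠ-identityˡ , λ x → ≈ᶠ-trans (*ᶠ-comm x (embed 1#)) (*ᶠ-identityˡ x)
        ; distrib = *ᶠ-distribˡ , λ x y z → ≈ᶠ-trans (*ᶠ-comm (y +ᶠ z) x)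
            (≈ᶠ-trans (*ᶠ-distribˡ x y z) (+ᶠ-cong (*ᶠ-comm x y) (*ᶠ-comm x z)))
        }
      ; *-comm = *ᶠ-comm
      }
    }

record FiniteField c ℓ (q : ℕ) : Set (Level.suc (c ⊔ ℓ)) where
  field
    commutativeRing : CommutativeRing c ℓ

  open CommutativeRing commutativeRing public

  field
    1≉0         : ¬ 1# ≈ 0#
    invertible  : ∀ x → ¬ x ≈ 0# → ∃ λ y → x * y ≈ 1#
    enumeration : Inverse (≡.setoid (Fin q)) setoid

  infix 4 _≈?_

  _≈?_ : ∀ x y → Dec (x ≈ y)
  x ≈? y = map′ from-injective (Inverse.from-cong enumeration) (from x FinP.≟ from y)
    where
    from : Carrier → Fin q
    from = Inverse.from enumeration
    from-injective : from x ≡ from y → x ≈ y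
    from-injective e = trans (sym (Inverse.inverseˡ enumeration ≡.refl)) (Inverse.inverseˡ enumeration e)

  open Algebra.Properties.Semiring.Exp semiring public using (_^_)

module _ (p : ℕ) (p-prime : Prime p) where

  open Padic p p-prime

  PIntegral : ℚ → Set
  PIntegral x = ¬ p ℕD.∣ ↧ₙ x

  -- The inclusion ℚ ∩ ℤₚ → ℤₚ, with the junk value 0 on the rest of ℚ.
  fromℚ : ℚ → ℤₚ
  fromℚ x with p ℕD.∣? ↧ₙ x
  ... | yes _  = fromℤ 0ℤ
  ... | no p∤d = fromℤ (↥ x) *ₚ inverseₚ (fromℤ (↧ x)) (λ e → p∤d (mod⇒∣ e))

  -- The ring of integers 𝒪 of the unramified extension of ℚₚ with residue field 𝔽:
  -- 𝒪 is free of finite rank over ℤₚ and reduce induces 𝒪 / p𝒪 ≅ 𝔽, so that p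
  -- generates the maximal ideal of the discrete valuation ring 𝒪.  These data
  -- determine 𝒪 up to isomorphism.
  record UnramifiedIntegers {c₁ ℓ₁} c₂ ℓ₂ {q} (𝔽 : FiniteField c₁ ℓ₁ q) : Set (c₁ ⊔ ℓ₁ ⊔ Level.suc (c₂ ⊔ ℓ₂)) where

    private
      module 𝔽 = FiniteField 𝔽

    field
      commutativeRing : CommutativeRing c₂ ℓ₂

    open CommutativeRing commutativeRing public
    open Algebra.Properties.Semiring.Exp semiring public using (_^_)
    open Algebra.Properties.Semiring.Sum semiring using (sum; sum-cong-≋; sum-replicate-zero; *-distribˡ-sum)

    field
      ι                : ℤₚ → Carrier
      ι-isHomomorphism : RingMorphisms.IsRingHomomorphism (CommutativeRing.rawRing ℤₚ-commutativeRing) rawRing ι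

      rank        : ℕ
      basis       : Fin rank → Carrier
      spanning    : ∀ x → ∃ λ (a : Fin rank → ℤₚ) → x ≈ sum (λ i → ι (a i) * basis i)
      independent : ∀ (a : Fin rank → ℤₚ) → sum (λ i → ι (a i) * basis i) ≈ 0# → ∀ i → a i ≈ₚ fromℤ 0ℤ

      reduce                : Carrier → 𝔽.Carrier
      reduce-isHomomorphism : RingMorphisms.IsRingHomomorphism rawRing 𝔽.rawRing reduce
      reduce-surjective     : ∀ y → ∃ λ x → reduce x 𝔽.≈ y
      reduce-kernel         : ∀ x → (reduce x 𝔽.≈ 𝔽.0#) ⇔ (∃ λ y → x ≈ ι (fromℤ (+ p)) * y)

    private
      module ι = RingMorphisms.IsRingHomomorphism ι-isHomomorphism

    open Fractions commutativeRing using (Regular)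

    p-regular : Regular (ι (fromℤ (+ p)))
    p-regular x px≈0 with spanning x
    ... | a , x≈ = trans x≈ (trans (sum-cong-≋ (λ i → trans (*-congʳ (trans (ι.⟦⟧-cong (a≈0 i)) ι.0#-homo)) (zeroˡ (basis i))))
                                   (sum-replicate-zero rank))
      where
      P = fromℤ (+ p)

      pa≈0 : ∀ i → P *ₚ a i ≈ₚ fromℤ 0ℤ
      pa≈0 = independent (λ i → P *ₚ a i) (trans
        (sum-cong-≋ (λ i → trans (*-congʳ (ι.*-homo P (a i))) (*-assoc (ι P) (ι (a i)) (basis i))))
        (trans (sym (*-distribˡ-sum (ι P) (λ i → ι (a i) * basis i)))
        (trans (*-congˡ (sym x≈)) px≈0)))

      a≈0 : ∀ i → a i ≈ₚ fromℤ 0ℤ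
      a≈0 i = p-regularₚ (a i) (pa≈0 i)

  -- By Hensel's lemma ω-root and ω-lift determine ω, which is then multiplicative;
  -- ω̄ is its inverse in the unit group.
  record TeichmüllerCharacter {c₁ ℓ₁ c₂ ℓ₂ q} {𝔽 : FiniteField c₁ ℓ₁ q}
                              (𝒪 : UnramifiedIntegers c₂ ℓ₂ 𝔽) : Set (c₁ ⊔ ℓ₁ ⊔ c₂ ⊔ ℓ₂) where

    private
      module 𝔽 = FiniteField 𝔽
    open UnramifiedIntegers 𝒪

    field
      ω         : ∀ x → ¬ x 𝔽.≈ 𝔽.0# → Carrier
      ω̄         : ∀ x → ¬ x 𝔽.≈ 𝔽.0# → Carrier
      ω-inverse : ∀ x x≉0 → ω x x≉0 * ω̄ x x≉0 ≈ 1#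
      ω-root    : ∀ x x≉0 → ω x x≉0 ^ (q ℕ.∸ 1) ≈ 1#
      ω-lift    : ∀ x x≉0 → reduce (ω x x≉0) 𝔽.≈ x

    -- All powers vanish at 0, the trivial one included.
    ω̄^ : ℕ → 𝔽.Carrier → Carrier
    ω̄^ j x with x 𝔽.≈? 𝔽.0#
    ... | yes _  = 0#
    ... | no x≉0 = ω̄ x x≉0 ^ j

-- Not the library's fracPart, which truncates towards zero.
⟨_⟩ : ℚ → ℚ
⟨ x ⟩ = x ℚ.- floor x ℚ./ 1

module Hypergeometric
  (p : ℕ) (p-prime : Prime p) (p-odd : p ≢ 2) (r : ℕ) .{{_ : NonZero r}}
  {c₁ ℓ₁ c₂ ℓ₂} {𝔽 : FiniteField c₁ ℓ₁ (p ℕ.^ r)}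
  (ℤ𝓆 : UnramifiedIntegers p p-prime c₂ ℓ₂ 𝔽) (T : TeichmüllerCharacter p p-prime ℤ𝓆) where

  open Padic p p-prime
  open Gamma p p-prime p-odd
  open TeichmüllerCharacter T using (ω̄^)
  private
    module 𝔽 = FiniteField 𝔽
    module ℤ𝓆 = UnramifiedIntegers ℤ𝓆

  open Fractions ℤ𝓆.commutativeRing using (Fraction; fraction; embed)

  ℚ𝓆 : CommutativeRing (c₂ ⊔ ℓ₂) ℓ₂
  ℚ𝓆 = Fractions.commutativeRing ℤ𝓆.commutativeRing

  open CommutativeRing ℚ𝓆 using (_*_; -_; 1#)
  open CommutativeRing ℚ𝓆 public using (_≈_; 0#)
  open Algebra.Properties.Semiring.Exp (CommutativeRing.semiring ℚ𝓆) using (_^_)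
  open Algebra.Properties.Monoid.Sum (CommutativeRing.+-monoid ℚ𝓆) using () renaming (sum to ∑)
  open Algebra.Properties.Monoid.Sum (CommutativeRing.*-monoid ℚ𝓆) using () renaming (sum to ∏)

  q : ℕ
  q = p ℕ.^ r

  instance
    q-1≢0 : NonZero (q ℕ.∸ 1)
    q-1≢0 = ℕ.>-nonZero (ℕP.m<n⇒0<n∸m (ℕP.<-≤-trans (ℕ.nonTrivial⇒n>1 p {{prime⇒nonTrivial p-prime}})
      (ℕP.≤-trans (ℕP.≤-reflexive (≡.sym (ℕP.^-identityʳ p))) (ℕP.^-monoʳ-≤ p (ℕ.>-nonZero⁻¹ r)))))

  fromℤₚ : ℤₚ → Fraction
  fromℤₚ x = embed (ℤ𝓆.ι x)

  1/p : Fraction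
  1/p = fraction ℤ𝓆.1# (ℤ𝓆.ι (fromℤ (+ p))) ℤ𝓆.p-regular

  [-p]^_ : ℤ → Fraction
  [-p]^ (+ n)    = (- fromℤₚ (fromℤ (+ p))) ^ n
  [-p]^ -[1+ n ] = (- 1/p) ^ suc n

  Γₚ-quotient : ℚ → ℚ → Fraction
  Γₚ-quotient x y = fromℤₚ (Γₚ (ℚ→ℤₚ x) *ₚ inverseₚ (Γₚ (ℚ→ℤₚ y)) (Γₚ-unit (ℚ→ℤₚ y)))
    where
    ℚ→ℤₚ : ℚ → ℤₚ
    ℚ→ℤₚ = fromℚ p p-prime

  factor : (a b : ℚ) (j k : ℕ) → Fraction
  factor a b j k =
      Γₚ-quotient ⟨ (a ℚ.- j/[q-1]) ℚ.* p^k ⟩ ⟨ a ℚ.* p^k ⟩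
    * Γₚ-quotient ⟨ (ℚ.- b ℚ.+ j/[q-1]) ℚ.* p^k ⟩ ⟨ ℚ.- b ℚ.* p^k ⟩
    * [-p]^ (ℤ.- floor (⟨ a ℚ.* p^k ⟩ ℚ.- j/[q-1] ℚ.* p^k)
             ℤ.- floor (⟨ ℚ.- b ℚ.* p^k ⟩ ℚ.+ j/[q-1] ℚ.* p^k))
    where
    j/[q-1] p^k : ℚ
    j/[q-1] = + j ℚ./ (q ℕ.∸ 1)
    p^k     = + (p ℕ.^ k) ℚ./ 1

  G : (m : ℕ) (a b : Fin m → ℚ) → 𝔽.Carrier → Fraction
  G m a b t =
    fromℤₚ (fromℚ p p-prime (-1ℤ ℚ./ (q ℕ.∸ 1)))
    * ∑ {q ℕ.∸ 1} (λ j → (- 1#) ^ (toℕ j ℕ.* m) * embed (ω̄^ (toℕ j) t)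
                         * ∏ {m} (λ i → ∏ {r} (λ k → factor (a i) (b i) (toℕ j) (toℕ k))))

-- The family aᵢ + l/n, indexed by the pairs (l , i) through Fin n × Fin m ≅ Fin (n * m).
withShifts : ∀ n .{{_ : NonZero n}} {m} → (Fin m → ℚ) → Fin (n ℕ.* m) → ℚ
withShifts n {m} a t = a (proj₂ li) ℚ.+ + toℕ (proj₁ li) ℚ./ n
  where
  li : Fin n × Fin m
  li = remQuot {n} m t

{-# OPTIONS --safe #-}

-- Put h = (q - 1)/n.  Replacing j by j + h in the product over l of the factors with parameters a + l/n and
-- b + l/n amounts to lowering l by one.  A factor is an expression in (a - j/(q-1)) pᵏ and (- b + j/(q-1)) pᵏ,
-- invariant when an integer is moved from the first to the second, times something independent of j, so that the
-- l's are permuted cyclically and the product is unchanged.  Hence the sum S defining G satisfies ζ S = S with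
-- ζ = ω̄(t)ʰ.  Since t is not an n-th power, tʰ ≠ 1, so that ζ - 1 is not in the maximal ideal and S = 0.
module Submission where

open import Defs
open import Algebra.Bundles using (CommutativeMonoid; CommutativeRing)
open import Algebra.Morphism.Structures using (module RingMorphisms)
import Algebra.Properties.CommutativeMonoid.Sum
import Algebra.Properties.CommutativeSemigroup
import Algebra.Properties.CommutativeSemiring.Exp
import Algebra.Properties.Group
import Algebra.Properties.Monoid.Mult
import Algebra.Properties.Monoid.Sum
import Algebra.Properties.Ring
import Algebra.Properties.Semiring.Exp
import Algebra.Properties.Semiring.Sum
import Algebra.Solver.Ring.NaturalCoefficients.Default
open import Data.Fin.Base using (Fin; zero; suc; toℕ; inject≤; _↑ˡ_; _↑ʳ_; remQuot)
import Data.Fin.Properties as FinP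
open import Data.Integer.Base as ℤ using (ℤ; +_; -[1+_]; 0ℤ; 1ℤ; -1ℤ)
import Data.Integer.DivMod as ℤM
open import Data.Integer.Divisibility.Signed as ℤD using ()
import Data.Integer.Properties as ℤP
open import Data.Integer.Tactic.RingSolver using (solve-∀)
open import Data.Nat.Base as ℕ using (ℕ; zero; suc; NonZero; s≤s)
import Data.Nat.Divisibility as ℕD
import Data.Nat.DivMod as ℕM
open import Data.Nat.Primality using (Prime; prime⇒irreducible)
import Data.Nat.Properties as ℕP
open import Data.Nat.Tactic.RingSolver using () renaming (solve-∀ to solve-∀ℕ)
open import Data.Product.Base using (∃; _×_; _,_; proj₁; proj₂; uncurry)
open import Data.Rational.Base as ℚ using (ℚ; mkℚ; floor; toℚᵘ)
import Data.Rational.Properties as ℚP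
open import Data.Rational.Solver using (module +-*-Solver)
open import Data.Rational.Unnormalised.Base as ℚᵘ using (mkℚᵘ; *≡*; *≤*; *<*)
import Data.Rational.Unnormalised.Properties as ℚᵘP
open import Data.Sum.Base using (inj₂)
open import Function.Base using (_∘_)
open import Function.Bundles using (Inverse; module Equivalence)
open import Level using (Level; _⊔_)
open import Relation.Binary.PropositionalEquality as ≡ using (_≡_; _≢_; cong; cong₂; refl)
import Relation.Binary.Reasoning.Setoid
open import Relation.Nullary using (¬_; yes; no; contradiction)

-- Floors and fractional parts

-- 𝒪 is given only as a free ℤₚ-module of finite rank with residue field 𝔽; that it is a domain is
-- not part of the data. That ζ - 1, lying outside the maximal ideal, is regular is therefore
-- derived from the basis: whatever it annihilates is divisible by every power of p, and an element
-- with that property has all coordinates 0. Fractions have regular denominators, which can be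
-- cancelled, so the conclusion passes from 𝒪 to its fraction ring.
--
-- The relation ζ S = S rests on three facts. The sign (-1)^(j n m) survives the shift by h because
-- its exponent grows by (q - 1) m and q is odd. The shift multiplies the character by ζ also at j =
-- 0: as 0 is an n-th power, t is nonzero and every value of the character is a genuine power.
-- Finally ζⁿ = 1 gives the summand the period q - 1, so that summing over a shifted window changes
-- nothing.
--
-- The inequality tʰ ≠ 1 is a count of roots, for which Fermat's theorem in 𝔽 is read off from the
-- (q - 1)-st roots of unity ω(x) by reduction.

/-distribʳ-+ : ∀ i j d .{{_ : NonZero d}} → (i ℤ.+ j) ℚ./ d ≡ i ℚ./ d ℚ.+ j ℚ./ d
/-distribʳ-+ i j (suc d) = ℚP.toℚᵘ-injective (begin
  toℚᵘ ((i ℤ.+ j) ℚ./ suc d)                   ≈⟨ ℚP.toℚᵘ-fromℚᵘ (mkℚᵘ (i ℤ.+ j) d) ⟩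
  mkℚᵘ (i ℤ.+ j) d                             ≈⟨ *≡* (lem i j (+ suc d)) ⟩
  mkℚᵘ i d ℚᵘ.+ mkℚᵘ j d                       ≈⟨ ℚᵘP.+-cong (ℚP.toℚᵘ-fromℚᵘ (mkℚᵘ i d)) (ℚP.toℚᵘ-fromℚᵘ (mkℚᵘ j d)) ⟨
  toℚᵘ (i ℚ./ suc d) ℚᵘ.+ toℚᵘ (j ℚ./ suc d)   ≈⟨ ℚP.toℚᵘ-homo-+ (i ℚ./ suc d) (j ℚ./ suc d) ⟨
  toℚᵘ (i ℚ./ suc d ℚ.+ j ℚ./ suc d)           ∎)
  where
  open import Relation.Binary.Reasoning.Setoid ℚᵘP.≃-setoid
  lem : ∀ i j D → (i ℤ.+ j) ℤ.* (D ℤ.* D) ≡ (i ℤ.* D ℤ.+ j ℤ.* D) ℤ.* D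
  lem = solve-∀

/-cross : ∀ i j d e .{{_ : NonZero d}} .{{_ : NonZero e}} → i ℤ.* + e ≡ j ℤ.* + d → i ℚ./ d ≡ j ℚ./ e
/-cross i j (suc d) (suc e) eq = ℚP.fromℚᵘ-cong {mkℚᵘ i d} {mkℚᵘ j e} (*≡* eq)

/1-cancel-< : ∀ {i j} → i ℚ./ 1 ℚ.< j ℚ./ 1 → i ℤ.< j
/1-cancel-< {i} {j} i<j with ℚᵘP.<-respˡ-≃ (ℚP.toℚᵘ-fromℚᵘ (mkℚᵘ i 0))
                             (ℚᵘP.<-respʳ-≃ (ℚP.toℚᵘ-fromℚᵘ (mkℚᵘ j 0)) (ℚP.toℚᵘ-mono-< i<j))
... | *<* lt = ≡.subst₂ ℤ._<_ (ℤP.*-identityʳ i) (ℤP.*-identityʳ j) lt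

floor-≤ : ∀ x → floor x ℚ./ 1 ℚ.≤ x
floor-≤ x@(mkℚ n d-1 _) = ℚP.toℚᵘ-cancel-≤ (ℚᵘP.≤-respˡ-≃ (ℚᵘP.≃-sym (ℚP.toℚᵘ-fromℚᵘ (mkℚᵘ (floor x) 0)))
  (*≤* (ℤP.≤-trans (ℤM.[n/d]*d≤n n (+ suc d-1)) (ℤP.≤-reflexive (≡.sym (ℤP.*-identityʳ n))))))

<-floor : ∀ x → x ℚ.< ℤ.suc (floor x) ℚ./ 1
<-floor x@(mkℚ n d-1 _) = ℚP.toℚᵘ-cancel-< (ℚᵘP.<-respʳ-≃ (ℚᵘP.≃-sym (ℚP.toℚᵘ-fromℚᵘ (mkℚᵘ (ℤ.suc (floor x)) 0)))
  (*<* (≡.subst₂ ℤ._<_ (≡.sym (ℤP.*-identityʳ n))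
    (cong (λ k → ℤ.suc k ℤ.* + suc d-1) (≡.sym (ℤM.div-pos-is-/ℕ n (suc d-1))))
    (ℤM.n<s[n/ℕd]*d n (suc d-1)))))

floor-unique : ∀ x k → k ℚ./ 1 ℚ.≤ x → x ℚ.< ℤ.suc k ℚ./ 1 → floor x ≡ k
floor-unique x k k≤x x<k+1 = ℤP.≤-antisym
  (below (ℚP.≤-<-trans (floor-≤ x) x<k+1))
  (below (ℚP.≤-<-trans k≤x (<-floor x)))
  where
  below : ∀ {i j} → i ℚ./ 1 ℚ.< ℤ.suc j ℚ./ 1 → i ℤ.≤ j
  below {i} {j} lt = ≡.subst (i ℤ.≤_) (ℤP.pred-suc j) (ℤP.i<j⇒i≤pred[j] (/1-cancel-< {i} {ℤ.suc j} lt))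

floor-+-/1 : ∀ x k → floor (x ℚ.+ k ℚ./ 1) ≡ floor x ℤ.+ k
floor-+-/1 x k = floor-unique (x ℚ.+ k ℚ./ 1) (floor x ℤ.+ k)
  (ℚP.≤-trans (ℚP.≤-reflexive (/-distribʳ-+ (floor x) k 1)) (ℚP.+-monoˡ-≤ (k ℚ./ 1) (floor-≤ x)))
  (ℚP.<-≤-trans (ℚP.+-monoˡ-< (k ℚ./ 1) (<-floor x)) (ℚP.≤-reflexive
    (≡.trans (≡.sym (/-distribʳ-+ (ℤ.suc (floor x)) k 1)) (cong (ℚ._/ 1) (ℤP.+-assoc 1ℤ (floor x) k)))))

⟨⟩-+-/1 : ∀ x k → ⟨ x ℚ.+ k ℚ./ 1 ⟩ ≡ ⟨ x ⟩
⟨⟩-+-/1 x k = begin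
  x ℚ.+ k ℚ./ 1 ℚ.- floor (x ℚ.+ k ℚ./ 1) ℚ./ 1      ≡⟨ cong (λ f → x ℚ.+ k ℚ./ 1 ℚ.- f ℚ./ 1) (floor-+-/1 x k) ⟩
  x ℚ.+ k ℚ./ 1 ℚ.- (floor x ℤ.+ k) ℚ./ 1            ≡⟨ cong (λ f → x ℚ.+ k ℚ./ 1 ℚ.- f) (/-distribʳ-+ (floor x) k 1) ⟩
  x ℚ.+ k ℚ./ 1 ℚ.- (floor x ℚ./ 1 ℚ.+ k ℚ./ 1)      ≡⟨ lem x (k ℚ./ 1) (floor x ℚ./ 1) ⟩
  x ℚ.- floor x ℚ./ 1                                ∎
  where
  open ≡.≡-Reasoning
  open +-*-Solver
  lem : ∀ x k f → x ℚ.+ k ℚ.- (f ℚ.+ k) ≡ x ℚ.- f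
  lem = solve 3 (λ x k f → (x :+ k) :- (f :+ k) := x :- f) refl

neg-/1 : ∀ k → (ℤ.- k) ℚ./ 1 ≡ ℚ.- (k ℚ./ 1)
neg-/1 k = ℚP.toℚᵘ-injective (ℚᵘP.≃-trans (ℚP.toℚᵘ-fromℚᵘ (mkℚᵘ (ℤ.- k) 0))
  (ℚᵘP.≃-trans (ℚᵘP.-‿cong (ℚᵘP.≃-sym (ℚP.toℚᵘ-fromℚᵘ (mkℚᵘ k 0)))) (ℚᵘP.≃-sym (ℚP.toℚᵘ-homo‿- (k ℚ./ 1)))))

-- The exponents in G are floors of a shifted fractional part. The correction `floor x` is free of
-- the shift y, hence of j.
floor-⟨⟩+ : ∀ x y → floor (⟨ x ⟩ ℚ.+ y) ≡ floor (x ℚ.+ y) ℤ.- floor x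
floor-⟨⟩+ x y = begin
  floor (x ℚ.- floor x ℚ./ 1 ℚ.+ y)             ≡⟨ cong floor (lem x (floor x ℚ./ 1) y) ⟩
  floor (x ℚ.+ y ℚ.+ ℚ.- (floor x ℚ./ 1))       ≡⟨ cong (λ f → floor (x ℚ.+ y ℚ.+ f)) (neg-/1 (floor x)) ⟨
  floor (x ℚ.+ y ℚ.+ (ℤ.- floor x) ℚ./ 1)       ≡⟨ floor-+-/1 (x ℚ.+ y) (ℤ.- floor x) ⟩
  floor (x ℚ.+ y) ℤ.- floor x                   ∎
  where
  open ≡.≡-Reasoning
  open +-*-Solver
  lem : ∀ x f y → x ℚ.- f ℚ.+ y ≡ x ℚ.+ y ℚ.+ ℚ.- f
  lem = solve 3 (λ x f y → (x :- f) :+ y := (x :+ y) :+ (:- f)) refl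

-- Powers in a finite field

module Polynomial {c ℓ} (R : CommutativeRing c ℓ) where

  open CommutativeRing R hiding (refl; zero)
  open Algebra.Properties.Semiring.Exp semiring using (_^_)
  open Algebra.Solver.Ring.NaturalCoefficients.Default commutativeSemiring
    using (solve; _:=_; _:+_; _:*_; con)
  open Relation.Binary.Reasoning.Setoid setoid
  private
    module R = CommutativeRing R

  -- Polynomial functions given by a Horner scheme with leading coefficient 1.
  data Monic : ℕ → (Carrier → Carrier) → Set (c ⊔ ℓ) where
    one    : ∀ {f} → (∀ x → f x ≈ 1#) → Monic 0 f
    horner : ∀ {d f g} a → Monic d g → (∀ x → f x ≈ a + x * g x) → Monic (suc d) f

  -- f(x) - f(a) = (x - a) g(x), with the negative terms moved across.
  divide : ∀ {d f} → Monic (suc d) f → ∀ a → ∃ λ g → Monic d g × (∀ x → f x + a * g x ≈ f a + x * g x)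
  divide {f = f} (horner {g = g} e (one g≈1) f≈) a = (λ _ → 1#) , one (λ _ → R.refl) , λ x → begin
    f x + a * 1#            ≈⟨ +-congʳ (trans (f≈ x) (+-congˡ (*-congˡ (g≈1 x)))) ⟩
    e + x * 1# + a * 1#     ≈⟨ solve 3 (λ e x a → e :+ x :* con 1 :+ a :* con 1 := e :+ a :* con 1 :+ x :* con 1) R.refl e x a ⟩
    e + a * 1# + x * 1#     ≈⟨ +-congʳ (trans (f≈ a) (+-congˡ (*-congˡ (g≈1 a)))) ⟨
    f a + x * 1#            ∎
  divide {f = f} (horner {g = g} e g-monic@(horner _ _ _) f≈) a with divide g-monic a
  ... | k , k-monic , gk = (λ x → g a + x * k x) , horner (g a) k-monic (λ _ → R.refl) , λ x → begin
    f x + a * (g a + x * k x)             ≈⟨ +-congʳ (f≈ x) ⟩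
    e + x * g x + a * (g a + x * k x)     ≈⟨ solve 6 (λ e x gx a ga kx → e :+ x :* gx :+ a :* (ga :+ x :* kx)
                                                       := e :+ a :* ga :+ x :* (gx :+ a :* kx)) R.refl e x (g x) a (g a) (k x) ⟩
    e + a * g a + x * (g x + a * k x)     ≈⟨ +-cong (sym (f≈ a)) (*-congˡ (gk x)) ⟩
    f a + x * (g a + x * k x)             ∎

  shift-Monic : ∀ {d f} k → Monic d f → Monic (k ℕ.+ d) (λ x → x ^ k * f x)
  shift-Monic zero    (one f≈1)        = one (λ x → trans (*-identityˡ _) (f≈1 x))
  shift-Monic zero    (horner a m f≈)  = horner a m (λ x → trans (*-identityˡ _) (f≈ x))
  shift-Monic (suc k) m = horner 0# (shift-Monic k m) (λ x → trans (*-assoc x (x ^ k) _) (sym (+-identityˡ _)))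

  -- (xⁿ⁽ᵉ⁺¹⁾ - tᵉ⁺¹) / (xⁿ - t)
  geometric : ℕ → Carrier → ℕ → Carrier → Carrier
  geometric n t zero    x = 1#
  geometric n t (suc e) x = t ^ suc e + x ^ n * geometric n t e x

  -- Multiplying by Xⁿ and adding tᵉ⁺¹ is one Horner step with coefficient tᵉ⁺¹ around n - 1 steps
  -- with coefficient 0, which requires n to be positive.
  geometric-Monic : ∀ n .{{_ : NonZero n}} t e → Monic (e ℕ.* n) (geometric n t e)
  geometric-Monic n       t zero    = one (λ _ → R.refl)
  geometric-Monic (suc n) t (suc e) =
    horner (t ^ suc e) (shift-Monic n (geometric-Monic (suc n) t e)) (λ x → +-congˡ (*-assoc x (x ^ n) _))

  -- The telescoping identity behind the quotient, written without subtraction so that the semiring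
  -- solver applies.
  geometric-sum : ∀ n t e x →
    x ^ n * geometric n t e x + t ^ suc e ≈ t * geometric n t e x + (x ^ n) ^ suc e
  geometric-sum n t zero    x =
    solve 2 (λ X t → X :* con 1 :+ t :* con 1 := t :* con 1 :+ X :* con 1) R.refl (x ^ n) t
  geometric-sum n t (suc e) x = begin
    X * (T + X * g) + t * T      ≈⟨ solve 4 (λ X T g t → X :* (T :+ X :* g) :+ t :* T
                                             := t :* T :+ X :* (X :* g :+ T)) R.refl X T g t ⟩
    t * T + X * (X * g + T)      ≈⟨ +-congˡ (*-congˡ (geometric-sum n t e x)) ⟩
    t * T + X * (t * g + X ^ suc e)  ≈⟨ solve 5 (λ X T g t Y → t :* T :+ X :* (t :* g :+ Y)
                                             := t :* (T :+ X :* g) :+ X :* Y) R.refl X T g t (X ^ suc e) ⟩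
    t * (T + X * g) + X * X ^ suc e   ∎
    where
    X = x ^ n
    T = t ^ suc e
    g = geometric n t e x

  module _ (1≉0 : ¬ 1# ≈ 0#) (cancel : ∀ {x y z} → ¬ x ≈ y → x * z ≈ y * z → z ≈ 0#) where

    -- Splitting off the root `x zero` leaves a quotient of smaller degree that vanishes at the
    -- other points, because `cancel` removes the nonzero differences. In degree 0 the function is
    -- the constant 1.
    ¬roots>degree : ∀ {d f} → Monic d f → (x : Fin (suc d) → Carrier) →
                    (∀ {i j} → x i ≈ x j → i ≡ j) → ¬ (∀ i → f (x i) ≈ 0#)
    ¬roots>degree (one f≈1) x x-inj fx≈0 = 1≉0 (trans (sym (f≈1 (x zero))) (fx≈0 zero))
    ¬roots>degree {f = f} f-monic@(horner _ _ _) x x-inj fx≈0 with divide f-monic (x zero)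
    ... | g , g-monic , fg = ¬roots>degree g-monic (λ i → x (suc i)) (λ e → FinP.suc-injective (x-inj e))
      (λ i → cancel (λ e → FinP.0≢1+n (x-inj e)) (begin
        x zero * g (x (suc i))                     ≈⟨ +-identityˡ _ ⟨
        0# + x zero * g (x (suc i))                ≈⟨ +-congʳ (fx≈0 (suc i)) ⟨
        f (x (suc i)) + x zero * g (x (suc i))     ≈⟨ fg (x (suc i)) ⟩
        f (x zero) + x (suc i) * g (x (suc i))     ≈⟨ +-congʳ (fx≈0 zero) ⟩
        0# + x (suc i) * g (x (suc i))             ≈⟨ +-identityˡ _ ⟩
        x (suc i) * g (x (suc i))                  ∎))

module _ {c ℓ q} (𝔽 : FiniteField c ℓ q) where

  open FiniteField 𝔽 hiding (refl; zero)
  open Algebra.Properties.Semiring.Exp semiring using (^-assocʳ; ^-congʳ)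
  open Algebra.Properties.Group +-group using (x∙y⁻¹≈ε⇒x≈y; ∙-cancelʳ)
  open Algebra.Properties.Ring ring using ([y-z]x≈yx-zx)
  open Polynomial commutativeRing
  open Relation.Binary.Reasoning.Setoid setoid

  *-cancelʳ-distinct : ∀ {x y z} → ¬ x ≈ y → x * z ≈ y * z → z ≈ 0#
  *-cancelʳ-distinct {x} {y} {z} x≉y xz≈yz with invertible (x - y) (λ e → x≉y (x∙y⁻¹≈ε⇒x≈y x y e))
  ... | u , u-inverse = begin
    z                       ≈⟨ *-identityˡ z ⟨
    1# * z                  ≈⟨ *-congʳ (trans (*-comm u (x - y)) u-inverse) ⟨
    u * (x - y) * z         ≈⟨ *-assoc u (x - y) z ⟩
    u * ((x - y) * z)       ≈⟨ *-congˡ ([y-z]x≈yx-zx z x y) ⟩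
    u * (x * z - y * z)     ≈⟨ *-congˡ (trans (+-congʳ xz≈yz) (-‿inverseʳ (y * z))) ⟩
    u * 0#                  ≈⟨ zeroʳ u ⟩
    0#                      ∎

  -- If t had order dividing h = e + 1 without being an n-th power, then X (Xⁿʰ - tʰ) / (Xⁿ - t) would
  -- vanish on all of 𝔽, although its degree n e + 1 is smaller than q = n h + 1.
  power≉1 : (∀ x → ¬ x ≈ 0# → x ^ (q ℕ.∸ 1) ≈ 1#) →
            ∀ n .{{_ : NonZero n}} h .{{_ : NonZero h}} → suc (h ℕ.* n) ≡ q →
            ∀ t → ¬ (∃ λ s → s ^ n ≈ t) → ¬ t ^ h ≈ 1#
  power≉1 fermat n (suc e) hn≡q t t-nonpower t^h≈1 =
    ¬roots>degree 1≉0 *-cancelʳ-distinct (horner 0# (geometric-Monic n t e) (λ x → sym (+-identityˡ (x * geometric n t e x))))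
      element element-injective (λ i → vanishes (element i))
    where
    -- The polynomial has degree e n + 1, so e n + 2 distinct points are one too many. They exist
    -- because q = n + e n + 1 and n is at least 1.
    element : Fin (suc (suc (e ℕ.* n))) → Carrier
    element i = Inverse.to enumeration (inject≤ i (ℕP.≤-trans
      (ℕ.s≤s (ℕP.+-monoˡ-≤ (e ℕ.* n) (ℕ.>-nonZero⁻¹ n))) (ℕP.≤-reflexive hn≡q)))

    element-injective : ∀ {i j} → element i ≈ element j → i ≡ j
    element-injective {i} {j} eq = FinP.inject≤-injective _ _ i j
      (≡.trans (≡.sym (Inverse.inverseʳ enumeration (sym eq))) (Inverse.inverseʳ enumeration (CommutativeRing.refl commutativeRing)))

    vanishes : ∀ x → x * geometric n t e x ≈ 0#
    vanishes x with x ≈? 0#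
    ... | yes x≈0 = trans (*-congʳ x≈0) (zeroˡ _)
    -- Here xⁿ and t are distinct, yet their h-th powers are both 1, by Fermat and by the assumption
    -- on t. Hence the geometric factor vanishes at x.
    ... | no  x≉0 = trans (*-congˡ (*-cancelʳ-distinct (λ x^n≈t → t-nonpower (x , x^n≈t))
                      (∙-cancelʳ 1# _ _ (begin
      x ^ n * geometric n t e x + 1#               ≈⟨ +-congˡ t^h≈1 ⟨
      x ^ n * geometric n t e x + t ^ suc e        ≈⟨ geometric-sum n t e x ⟩
      t * geometric n t e x + (x ^ n) ^ suc e      ≈⟨ +-congˡ (^-assocʳ x n (suc e)) ⟩
      t * geometric n t e x + x ^ (n ℕ.* suc e)    ≈⟨ +-congˡ (^-congʳ x (≡.trans (ℕP.*-comm n (suc e)) (cong (ℕ._∸ 1) hn≡q))) ⟩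
      t * geometric n t e x + x ^ (q ℕ.∸ 1)          ≈⟨ +-congˡ (fermat x x≉0) ⟩
      t * geometric n t e x + 1#                   ∎)))) (zeroʳ x)

-- Finite sums

-- Written additively, but applied to sums and products alike: over the multiplicative monoid
-- `partialSum` is a partial product and `_^ℤ⟨_⟩_` an integer power.
module FiniteSum {c ℓ} (M : CommutativeMonoid c ℓ) where

  open CommutativeMonoid M renaming (_∙_ to _+_; ∙-cong to +-cong; ∙-congˡ to +-congˡ; ∙-congʳ to +-congʳ)
    hiding (refl)
  open Algebra.Properties.CommutativeMonoid.Sum M
  open Algebra.Properties.Monoid.Mult monoid using () renaming (_×_ to _·_)
  open Algebra.Properties.CommutativeSemigroup commutativeSemigroup using (interchange)
  open Relation.Binary.Reasoning.Setoid setoid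
  private
    module M = CommutativeMonoid M

  sum-++ : ∀ m {n} (f : Fin (m ℕ.+ n) → Carrier) → sum f ≈ sum (λ i → f (i ↑ˡ n)) + sum (λ j → f (m ↑ʳ j))
  sum-++ zero    f = sym (identityˡ _)
  sum-++ (suc m) f = trans (+-congˡ (sum-++ m (f ∘ suc))) (sym (assoc _ _ _))

  sum-remQuot : ∀ m {n} (f : Fin m → Fin n → Carrier) →
                sum {m ℕ.* n} (λ t → uncurry f (remQuot {m} n t)) ≈ sum (λ i → sum (f i))
  sum-remQuot zero        f = M.refl
  sum-remQuot (suc m) {n} f = trans (sum-++ n _) (+-cong
    (sum-cong-≋ (λ j → reflexive (cong (uncurry f) (FinP.remQuot-combine {suc m} {n} zero j))))
    (trans (sum-cong-≋ (λ t → reflexive (cong (uncurry f) (remQuot-↑ʳ t)))) (sum-remQuot m (f ∘ suc))))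
    where
    remQuot-↑ʳ : ∀ t → remQuot {suc m} n (n ↑ʳ t) ≡ (suc (proj₁ (remQuot {m} n t)) , proj₂ (remQuot {m} n t))
    remQuot-↑ʳ t rewrite FinP.splitAt-↑ʳ n (m ℕ.* n) t = refl

  partialSum : (ℕ → Carrier) → ℕ → Carrier
  partialSum f n = sum {n} (λ i → f (toℕ i))

  partialSum-+ : ∀ f m n → partialSum f (m ℕ.+ n) ≈ partialSum f m + partialSum (λ i → f (m ℕ.+ i)) n
  partialSum-+ f zero    n = sym (identityˡ _)
  partialSum-+ f (suc m) n = trans (+-congˡ (partialSum-+ (f ∘ suc) m n)) (sym (assoc _ _ _))

  partialSum-suc : ∀ f n → partialSum f (suc n) ≈ partialSum f n + f n
  partialSum-suc f n = begin
    partialSum f (suc n)                      ≡⟨ cong (partialSum f) (ℕP.+-comm 1 n) ⟩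
    partialSum f (n ℕ.+ 1)                    ≈⟨ partialSum-+ f n 1 ⟩
    partialSum f n + (f (n ℕ.+ 0) + ε)        ≈⟨ +-congˡ (trans (identityʳ _) (reflexive (cong f (ℕP.+-identityʳ n)))) ⟩
    partialSum f n + f n                      ∎

  -- In the multiplicative monoid this is the cyclic permutation of the l's.
  partialSum-rotate : ∀ f n → f n ≈ f 0 → partialSum (f ∘ suc) n ≈ partialSum f n
  partialSum-rotate f zero    _     = M.refl
  partialSum-rotate f (suc n) fn≈f0 = begin
    partialSum (f ∘ suc) (suc n)            ≈⟨ partialSum-suc (f ∘ suc) n ⟩
    partialSum (f ∘ suc) n + f (suc n)      ≈⟨ comm _ _ ⟩
    f (suc n) + partialSum (f ∘ suc) n      ≈⟨ +-congʳ fn≈f0 ⟩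
    f 0 + partialSum (f ∘ suc) n            ∎

  infixr 8 _^ℤ⟨_⟩_

  -- y stands for the inverse of x.
  _^ℤ⟨_⟩_ : Carrier → Carrier → ℤ → Carrier
  x ^ℤ⟨ y ⟩ (+ n)    = n · x
  x ^ℤ⟨ y ⟩ -[1+ n ] = suc n · y

  module _ {x y} (x+y≈0 : x + y ≈ ε) where

    open Algebra.Properties.Monoid.Mult monoid using (×-homo-+)

    multiple-⊖ : ∀ m n → x ^ℤ⟨ y ⟩ (m ℤ.⊖ n) ≈ m · x + n · y
    multiple-⊖ m       zero    = sym (identityʳ _)
    multiple-⊖ zero    (suc n) = sym (identityˡ _)
    multiple-⊖ (suc m) (suc n) = begin
      x ^ℤ⟨ y ⟩ (suc m ℤ.⊖ suc n)       ≡⟨ cong (x ^ℤ⟨ y ⟩_) (ℤP.[1+m]⊖[1+n]≡m⊖n m n) ⟩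
      x ^ℤ⟨ y ⟩ (m ℤ.⊖ n)               ≈⟨ multiple-⊖ m n ⟩
      m · x + n · y                     ≈⟨ identityˡ _ ⟨
      ε + (m · x + n · y)               ≈⟨ +-congʳ x+y≈0 ⟨
      x + y + (m · x + n · y)           ≈⟨ interchange x y (m · x) (n · y) ⟩
      x + m · x + (y + n · y)           ∎

    multiple-+ : ∀ i j → x ^ℤ⟨ y ⟩ (i ℤ.+ j) ≈ x ^ℤ⟨ y ⟩ i + x ^ℤ⟨ y ⟩ j
    multiple-+ (+ m)    (+ n)    = ×-homo-+ x m n
    multiple-+ (+ m)    -[1+ n ] = multiple-⊖ m (suc n)
    multiple-+ -[1+ m ] (+ n)    = trans (multiple-⊖ n (suc m)) (comm _ _)
    multiple-+ -[1+ m ] -[1+ n ] = begin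
      suc (suc (m ℕ.+ n)) · y           ≡⟨ cong (λ k → suc k · y) (ℕP.+-suc m n) ⟨
      (suc m ℕ.+ suc n) · y             ≈⟨ ×-homo-+ y (suc m) (suc n) ⟩
      suc m · y + suc n · y             ∎

module _ {c ℓ} (R : CommutativeRing c ℓ) where

  open CommutativeRing R hiding (refl; zero)
  open Algebra.Properties.Semiring.Exp semiring using (_^_)
  open Algebra.Properties.Semiring.Sum semiring using (*-distribˡ-sum; sum-cong-≋)
  open Algebra.Properties.Group +-group using (∙-cancelˡ)
  open FiniteSum +-commutativeMonoid
  open Relation.Binary.Reasoning.Setoid setoid

  quasiperiodic-iterate : ∀ {f : ℕ → Carrier} {h ζ} → (∀ j → f (h ℕ.+ j) ≈ ζ * f j) →
                          ∀ n j → f (n ℕ.* h ℕ.+ j) ≈ ζ ^ n * f j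
  quasiperiodic-iterate f-shift zero j = sym (*-identityˡ _)
  quasiperiodic-iterate {f} {h} {ζ} f-shift (suc n) j = begin
    f (h ℕ.+ n ℕ.* h ℕ.+ j)        ≡⟨ cong f (ℕP.+-assoc h (n ℕ.* h) j) ⟩
    f (h ℕ.+ (n ℕ.* h ℕ.+ j))      ≈⟨ f-shift (n ℕ.* h ℕ.+ j) ⟩
    ζ * f (n ℕ.* h ℕ.+ j)          ≈⟨ *-congˡ (quasiperiodic-iterate f-shift n j) ⟩
    ζ * (ζ ^ n * f j)              ≈⟨ *-assoc ζ (ζ ^ n) (f j) ⟨
    ζ ^ suc n * f j                ∎

  -- The sum of the first n h + h terms is split once after h terms and once after n h terms. The
  -- last h terms repeat the first h because ζⁿ = 1, and these cancel.
  quasiperiodic-sum : ∀ {f : ℕ → Carrier} {h ζ} n → (∀ j → f (h ℕ.+ j) ≈ ζ * f j) → ζ ^ n ≈ 1# →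
                      ζ * partialSum f (n ℕ.* h) ≈ partialSum f (n ℕ.* h)
  quasiperiodic-sum {f} {h} {ζ} n f-shift ζ^n≈1 = ∙-cancelˡ (partialSum f h) _ _ (begin
    partialSum f h + ζ * partialSum f N                        ≈⟨ +-congˡ (trans (*-distribˡ-sum {N} ζ (λ i → f (toℕ i)))
                                                                    (sum-cong-≋ {N} (λ i → sym (f-shift (toℕ i))))) ⟩
    partialSum f h + partialSum (λ i → f (h ℕ.+ i)) N          ≈⟨ partialSum-+ f h N ⟨
    partialSum f (h ℕ.+ N)                                     ≡⟨ cong (partialSum f) (ℕP.+-comm h N) ⟩
    partialSum f (N ℕ.+ h)                                     ≈⟨ partialSum-+ f N h ⟩
    partialSum f N + partialSum (λ i → f (N ℕ.+ i)) h          ≈⟨ +-congˡ (sum-cong-≋ {h} (λ i → trans (quasiperiodic-iterate f-shift n (toℕ i))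
                                                                    (trans (*-congʳ ζ^n≈1) (*-identityˡ _)))) ⟩
    partialSum f N + partialSum f h                            ≈⟨ +-comm _ _ ⟩
    partialSum f h + partialSum f N                            ∎)
    where
    N = n ℕ.* h

-- Regular elements of unramified extensions

module _ {p} {p-prime : Prime p} {c₁ ℓ₁ c₂ ℓ₂ q} {𝔽 : FiniteField c₁ ℓ₁ q} (𝒪 : UnramifiedIntegers p p-prime c₂ ℓ₂ 𝔽) where

  open Padic p p-prime
  private
    module 𝔽 = FiniteField 𝔽
  open UnramifiedIntegers 𝒪 hiding (refl; zero)
  open Algebra.Properties.Semiring.Sum semiring using (sum; sum-cong-≋; sum-replicate-zero; *-distribˡ-sum; ∑-distrib-+)
  open Algebra.Properties.Ring ring using (-‿distribˡ-*; -‿distribʳ-*; -1*x≈-x)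
  open Algebra.Properties.Group +-group using (⁻¹-involutive)
  open Relation.Binary.Reasoning.Setoid setoid
  private
    module ι = RingMorphisms.IsRingHomomorphism ι-isHomomorphism
    module reduce = RingMorphisms.IsRingHomomorphism reduce-isHomomorphism
    

  p^ : ℕ → Carrier
  p^ N = ι (fromℤ (+ (p ℕ.^ N)))

  p^-suc : ∀ N → p^ (suc N) ≈ ι (fromℤ (+ p)) * p^ N
  p^-suc N = trans (ι.⟦⟧-cong (≈ₚ-intro (λ _ → ≡⇒mod (ℤP.pos-* p (p ℕ.^ N))))) (ι.*-homo (fromℤ (+ p)) (fromℤ (+ (p ℕ.^ N))))

  combination : (Fin rank → ℤₚ) → Carrier
  combination a = sum (λ i → ι (a i) * basis i)

  combination-sub : ∀ a c → combination (λ i → a i +ₚ -ₚ c i) ≈ combination a - combination c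
  combination-sub a c = begin
    sum (λ i → ι (a i +ₚ -ₚ c i) * basis i)        ≈⟨ sum-cong-≋ term ⟩
    sum (λ i → f i + - 1# * g i)                   ≈⟨ ∑-distrib-+ f (λ i → - 1# * g i) ⟩
    sum f + sum (λ i → - 1# * g i)                 ≈⟨ +-congˡ (*-distribˡ-sum (- 1#) g) ⟨
    sum f + - 1# * sum g                           ≈⟨ +-congˡ (-1*x≈-x (sum g)) ⟩
    sum f - sum g                                  ∎
    where
    f g : Fin rank → Carrier
    f i = ι (a i) * basis i
    g i = ι (c i) * basis i

    term : ∀ i → ι (a i +ₚ -ₚ c i) * basis i ≈ f i + - 1# * g i
    term i = begin
      ι (a i +ₚ -ₚ c i) * basis i                  ≈⟨ *-congʳ (ι.+-homo (a i) (-ₚ c i)) ⟩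
      (ι (a i) + ι (-ₚ c i)) * basis i             ≈⟨ distribʳ (basis i) (ι (a i)) (ι (-ₚ c i)) ⟩
      f i + ι (-ₚ c i) * basis i                   ≈⟨ +-congˡ (*-congʳ (ι.-‿homo (c i))) ⟩
      f i + - ι (c i) * basis i                    ≈⟨ +-congˡ (-‿distribˡ-* (ι (c i)) (basis i)) ⟨
      f i + - (g i)                                ≈⟨ +-congˡ (-1*x≈-x (g i)) ⟨
      f i + - 1# * g i                             ∎

  combination-* : ∀ c b → combination (λ i → c *ₚ b i) ≈ ι c * combination b
  combination-* c b = begin
    sum (λ i → ι (c *ₚ b i) * basis i)             ≈⟨ sum-cong-≋ term ⟩
    sum (λ i → ι c * (ι (b i) * basis i))          ≈⟨ *-distribˡ-sum (ι c) (λ i → ι (b i) * basis i) ⟨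
    ι c * combination b                            ∎
    where
    term : ∀ i → ι (c *ₚ b i) * basis i ≈ ι c * (ι (b i) * basis i)
    term i = trans (*-congʳ (ι.*-homo c (b i))) (*-assoc (ι c) (ι (b i)) (basis i))

  combination-injective : ∀ a c → combination a ≈ combination c → ∀ i → a i ≈ₚ c i
  combination-injective a c Σa≈Σc i = ≈ₚ-intro (λ N → mod-intro
    (≡.subst (+ (p ℕ.^ N) ℤD.∣_) (ℤP.+-identityʳ (residue (a i) N ℤ.- residue (c i) N)) (∣difference (at a-c≈0 N))))
    where
    a-c≈0 : a i +ₚ -ₚ c i ≈ₚ fromℤ 0ℤ
    a-c≈0 = independent (λ i → a i +ₚ -ₚ c i) (trans (combination-sub a c) (trans (+-congʳ Σa≈Σc) (-‿inverseʳ (combination c)))) i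

  -- By uniqueness of coordinates in the basis, each coordinate of x is a multiple of every pᴺ in
  -- ℤₚ, so its residue modulo pᴺ is 0 for all N.
  p-divisible⇒0 : ∀ x → (∀ N → ∃ λ y → x ≈ p^ N * y) → x ≈ 0#
  p-divisible⇒0 x p^∣x = trans x≈Σa (trans (sum-cong-≋ term) (sum-replicate-zero rank))
    where
    a : Fin rank → ℤₚ
    a = proj₁ (spanning x)

    x≈Σa : x ≈ combination a
    x≈Σa = proj₂ (spanning x)

    module _ (N : ℕ) where
      y : Carrier
      y = proj₁ (p^∣x N)

      b : Fin rank → ℤₚ
      b = proj₁ (spanning y)

      p^b : Fin rank → ℤₚ
      p^b i = fromℤ (+ (p ℕ.^ N)) *ₚ b i

      Σa≈Σp^b : combination a ≈ combination p^b
      Σa≈Σp^b = begin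
        combination a              ≈⟨ x≈Σa ⟨
        x                          ≈⟨ proj₂ (p^∣x N) ⟩
        p^ N * y                   ≈⟨ *-congˡ (proj₂ (spanning y)) ⟩
        p^ N * combination b       ≈⟨ combination-* (fromℤ (+ (p ℕ.^ N))) b ⟨
        combination p^b            ∎

      residue≡0 : ∀ i → residue (a i) N ≡ 0ℤ mod (p ℕ.^ N)
      residue≡0 i = mod-trans (at (combination-injective a p^b Σa≈Σp^b i) N)
        (mod-trans (mod-*ʳ (residue (b i) N) (∣⇒mod (ℕD.∣-refl {p ℕ.^ N}))) (≡⇒mod (ℤP.*-zeroˡ (residue (b i) N))))

    term : ∀ i → ι (a i) * basis i ≈ 0#
    term i = trans (*-congʳ (trans (ι.⟦⟧-cong (≈ₚ-intro (λ N → residue≡0 N i))) ι.0#-homo)) (zeroˡ (basis i))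

  module _ {x} (x∉𝔪 : ¬ reduce x 𝔽.≈ 𝔽.0#) where

    private
      π v : Carrier
      π = ι (fromℤ (+ p))
      -- A lift of the inverse of x in the residue field, so that x v - 1 lies in the kernel of
      -- `reduce`.
      v = proj₁ (reduce-surjective (proj₁ (𝔽.invertible (reduce x) x∉𝔪)))

      xv-1∈𝔪 : reduce (x * v - 1#) 𝔽.≈ 𝔽.0#
      xv-1∈𝔪 = 𝔽.trans (reduce.+-homo (x * v) (- 1#)) (𝔽.trans
        (𝔽.+-cong (𝔽.trans (reduce.*-homo x v) (𝔽.trans (𝔽.*-congˡ (proj₂ (reduce-surjective (proj₁ (𝔽.invertible (reduce x) x∉𝔪)))))
                    (proj₂ (𝔽.invertible (reduce x) x∉𝔪))))
                  (𝔽.trans (reduce.-‿homo 1#) (𝔽.-‿cong reduce.1#-homo)))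
        (𝔽.-‿inverseʳ 𝔽.1#))

      z : Carrier
      z = proj₁ (Equivalence.to (reduce-kernel (x * v - 1#)) xv-1∈𝔪)

      xv-1≈πz : x * v - 1# ≈ π * z
      xv-1≈πz = proj₂ (Equivalence.to (reduce-kernel (x * v - 1#)) xv-1∈𝔪)

      annihilated-* : ∀ y w → x * y ≈ 0# → x * (w * y) ≈ 0#
      annihilated-* y w xy≈0 = begin
        x * (w * y)      ≈⟨ *-assoc x w y ⟨
        x * w * y        ≈⟨ *-congʳ (*-comm x w) ⟩
        w * x * y        ≈⟨ *-assoc w x y ⟩
        w * (x * y)      ≈⟨ *-congˡ xy≈0 ⟩
        w * 0#           ≈⟨ zeroʳ w ⟩
        0#               ∎

      -- x v = 1 + π z, so x y = 0 forces y = - π z y.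
      annihilated-divisible : ∀ y → x * y ≈ 0# → y ≈ π * (- z * y)
      annihilated-divisible y xy≈0 = begin
        y                                ≈⟨ ⁻¹-involutive y ⟨
        - (- y)                          ≈⟨ -‿cong (-1*x≈-x y) ⟨
        - (- 1# * y)                     ≈⟨ -‿cong (+-identityˡ _) ⟨
        - (0# + - 1# * y)                ≈⟨ -‿cong (+-congʳ (trans (*-assoc x v y) (annihilated-* y v xy≈0))) ⟨
        - (x * v * y + - 1# * y)         ≈⟨ -‿cong (distribʳ y (x * v) (- 1#)) ⟨
        - ((x * v - 1#) * y)             ≈⟨ -‿cong (*-congʳ xv-1≈πz) ⟩
        - (π * z * y)                    ≈⟨ -‿cong (*-assoc π z y) ⟩
        - (π * (z * y))                  ≈⟨ -‿distribʳ-* π (z * y) ⟩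
        π * - (z * y)                    ≈⟨ *-congˡ (-‿distribˡ-* z y) ⟩
        π * (- z * y)                    ∎

    -- If x annihilates y then y = π (- z y), and x annihilates - z y as well. The step can thus be
    -- repeated, which makes y divisible by every power of p.
    regular-outside-maximal-ideal : ∀ y → x * y ≈ 0# → y ≈ 0#
    regular-outside-maximal-ideal y xy≈0 = p-divisible⇒0 y (λ N → quotient N , proj₂ (divisible N))
      where
      quotient : ℕ → Carrier
      quotient zero    = y
      quotient (suc N) = - z * quotient N

      divisible : ∀ N → x * quotient N ≈ 0# × y ≈ p^ N * quotient N
      divisible zero    = xy≈0 , sym (trans (*-congʳ ι.1#-homo) (*-identityˡ y))
      divisible (suc N) = annihilated-* (quotient N) (- z) (proj₁ (divisible N)) , (begin
        y                                    ≈⟨ proj₂ (divisible N) ⟩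
        p^ N * quotient N                    ≈⟨ *-congˡ (annihilated-divisible (quotient N) (proj₁ (divisible N))) ⟩
        p^ N * (π * (- z * quotient N))      ≈⟨ *-assoc (p^ N) π (- z * quotient N) ⟨
        p^ N * π * (- z * quotient N)        ≈⟨ *-congʳ (trans (*-comm (p^ N) π) (sym (p^-suc N))) ⟩
        p^ (suc N) * (- z * quotient N)      ∎)

  fixed⇒0 : ∀ {z} → ¬ reduce z 𝔽.≈ 𝔽.1# → ∀ y → z * y ≈ y → y ≈ 0#
  fixed⇒0 {z} z≉1 y zy≈y = regular-outside-maximal-ideal {z - 1#} z-1∉𝔪 y (begin
    (z - 1#) * y            ≈⟨ distribʳ y z (- 1#) ⟩
    z * y + - 1# * y        ≈⟨ +-cong zy≈y (-1*x≈-x y) ⟩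
    y - y                   ≈⟨ -‿inverseʳ y ⟩
    0#                      ∎)
    where
    module 𝔽-Group = Algebra.Properties.Group 𝔽.+-group

    z-1∉𝔪 : ¬ reduce (z - 1#) 𝔽.≈ 𝔽.0#
    z-1∉𝔪 e = z≉1 (𝔽-Group.x∙y⁻¹≈ε⇒x≈y (reduce z) 𝔽.1# (𝔽.trans
      (𝔽.+-congˡ (𝔽.sym (𝔽.trans (reduce.-‿homo 1#) (𝔽.-‿cong reduce.1#-homo))))
      (𝔽.trans (𝔽.sym (reduce.+-homo z (- 1#))) e)))

-- Parity of q - 1, signs and powers

odd-prime-power : ∀ {p} → Prime p → p ≢ 2 → ∀ r → ∃ λ k → p ℕ.^ r ≡ suc (2 ℕ.* k)
odd-prime-power {p} p-prime p≢2 = go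
  where
  p%2≡1 : p ℕM.% 2 ≡ 1
  p%2≡1 with p ℕM.% 2 in eq | ℕM.m%n<n p 2
  ... | 1 | _ = refl
  ... | suc (suc _) | s≤s (s≤s ())
  ... | 0 | _ with prime⇒irreducible p-prime (ℕD.m%n≡0⇒n∣m p 2 eq)
  ...   | inj₂ 2≡p = contradiction (≡.sym 2≡p) p≢2

  p≡1+2k : p ≡ suc (2 ℕ.* (p ℕM./ 2))
  p≡1+2k = ≡.trans (ℕM.m≡m%n+[m/n]*n p 2) (cong₂ ℕ._+_ p%2≡1 (ℕP.*-comm (p ℕM./ 2) 2))

  lem : ∀ k l → suc (2 ℕ.* k) ℕ.* suc (2 ℕ.* l) ≡ suc (2 ℕ.* (k ℕ.+ l ℕ.+ 2 ℕ.* (k ℕ.* l)))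
  lem = solve-∀ℕ

  go : ∀ r → ∃ λ k → p ℕ.^ r ≡ suc (2 ℕ.* k)
  go zero    = 0 , refl
  go (suc r) = let l , p^r≡1+2l = go r in
    p ℕM./ 2 ℕ.+ l ℕ.+ 2 ℕ.* (p ℕM./ 2 ℕ.* l) , ≡.trans (cong₂ ℕ._*_ p≡1+2k p^r≡1+2l) (lem (p ℕM./ 2) l)

module _ {c ℓ} (R : CommutativeRing c ℓ) where

  open CommutativeRing R hiding (refl; zero)
  open Algebra.Properties.Semiring.Exp semiring using (_^_; ^-assocʳ; ^-congˡ)
  open Algebra.Properties.Ring ring using (-1*x≈-x; -‿distribˡ-*; -‿distribʳ-*)
  open Algebra.Properties.Group +-group using (⁻¹-involutive)

  1^n≈1 : ∀ n → 1# ^ n ≈ 1#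
  1^n≈1 zero    = CommutativeRing.refl R
  1^n≈1 (suc n) = trans (*-identityˡ _) (1^n≈1 n)

  -1^2n≈1 : ∀ n → (- 1#) ^ (2 ℕ.* n) ≈ 1#
  -1^2n≈1 n = trans (sym (^-assocʳ (- 1#) 2 n)) (trans
    (^-congˡ n (trans (*-congˡ (*-identityʳ (- 1#))) (trans (-1*x≈-x (- 1#)) (⁻¹-involutive 1#))))
    (1^n≈1 n))

  neg-inverse : ∀ {x y} → x * y ≈ 1# → - x * - y ≈ 1#
  neg-inverse {x} {y} xy≈1 = trans (sym (-‿distribˡ-* x (- y)))
    (trans (-‿cong (sym (-‿distribʳ-* x y))) (trans (⁻¹-involutive (x * y)) xy≈1))

  -- The function e is specified by its two clauses because `[-p]^_` is defined by such cases.
  -- Negating two mutually inverse elements keeps them inverse, so the law for integer powers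
  -- applies.
  ±power-homo : ∀ x y → x * y ≈ 1# → (e : ℤ → Carrier) →
                (∀ n → e (+ n) ≈ (- x) ^ n) → (∀ n → e -[1+ n ] ≈ (- y) ^ suc n) →
                ∀ i j → e (i ℤ.+ j) ≈ e i * e j
  ±power-homo x y xy≈1 e e-pos e-neg i j =
    trans (e≈ (i ℤ.+ j)) (trans (multiple-+ (neg-inverse xy≈1) i j) (sym (*-cong (e≈ i) (e≈ j))))
    where
    open FiniteSum *-commutativeMonoid
    e≈ : ∀ i → e i ≈ (- x) ^ℤ⟨ - y ⟩ i
    e≈ (+ n)    = e-pos n
    e≈ -[1+ n ] = e-neg n

  0^n≈0 : ∀ n .{{_ : NonZero n}} → 0# ^ n ≈ 0#
  0^n≈0 (suc n) = zeroˡ (0# ^ n)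

module _ {c₁ ℓ₁ c₂ ℓ₂} (R : CommutativeRing c₁ ℓ₁) (S : CommutativeRing c₂ ℓ₂) where

  private
    module R where
      open CommutativeRing R public
      open Algebra.Properties.Semiring.Exp semiring using (_^_) public
    module S where
      open CommutativeRing S public
      open Algebra.Properties.Semiring.Exp semiring using (_^_) public

  ^-homo : (f : R.Carrier → S.Carrier) → f R.1# S.≈ S.1# → (∀ x y → f (x R.* y) S.≈ f x S.* f y) →
           ∀ x n → f (x R.^ n) S.≈ f x S.^ n
  ^-homo f f-1 f-* x zero    = f-1
  ^-homo f f-1 f-* x (suc n) = S.trans (f-* x (x R.^ n)) (S.*-congˡ (^-homo f f-1 f-* x n))

-- The ring inside its ring of fractions

module Embedding {c ℓ} (R : CommutativeRing c ℓ) where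

  open CommutativeRing R hiding (refl; zero)
  open Fractions R
  open Algebra.Properties.Semiring.Exp semiring using (_^_)
  private
    module K = CommutativeRing commutativeRing
    open Algebra.Properties.Semiring.Exp K.semiring using () renaming (_^_ to _^ᶠ_)

  embed-cong : ∀ {x y} → x ≈ y → embed x K.≈ embed y
  embed-cong x≈y = ≈ᶠ-intro (*-congʳ x≈y)

  embed-* : ∀ x y → embed (x * y) K.≈ embed x K.* embed y
  embed-* x y = ≈ᶠ-intro (*-congˡ (*-identityˡ 1#))

  embed-^ : ∀ x n → embed (x ^ n) K.≈ embed x ^ᶠ n
  embed-^ = ^-homo R commutativeRing embed (≈ᶠ-intro (CommutativeRing.refl R)) embed-*

  embed-power≈1 : ∀ x n → x ^ n ≈ 1# → embed x ^ᶠ n K.≈ K.1#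
  embed-power≈1 x n x^n≈1 = K.trans {embed x ^ᶠ n} {embed (x ^ n)} {K.1#}
    (K.sym {embed (x ^ n)} {embed x ^ᶠ n} (embed-^ x n)) (embed-cong x^n≈1)

  -- The denominator d is regular, so it can be cancelled from the cross-multiplied equation, which
  -- leaves z a = a for the numerator.
  embed-fixed⇒0 : ∀ {z} → (∀ x → z * x ≈ x → x ≈ 0#) → ∀ f → embed z K.* f K.≈ f → f K.≈ K.0#
  embed-fixed⇒0 {z} fixed⇒0 (fraction a d d-regular) (≈ᶠ-intro zad≈a1d) = ≈ᶠ-intro
    (trans (*-identityʳ a) (trans (fixed⇒0 a (regular-cancel d-regular
      (trans (*-comm d (z * a)) (trans zad≈a1d (trans (*-comm a (1# * d)) (*-congʳ (*-identityˡ d)))))))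
      (sym (zeroˡ d))))

-- The Teichmüller character and its reduction

module _
  {p : ℕ} {p-prime : Prime p} {c₁ ℓ₁ c₂ ℓ₂ q} {𝔽 : FiniteField c₁ ℓ₁ q}
  {𝒪 : UnramifiedIntegers p p-prime c₂ ℓ₂ 𝔽} (T : TeichmüllerCharacter p p-prime 𝒪) where

  private
    module 𝔽 where
      open FiniteField 𝔽 public
      open Algebra.Properties.Semiring.Exp semiring using (^-congˡ) public
    module 𝒪 where
      open UnramifiedIntegers 𝒪 public
      open Algebra.Properties.CommutativeSemiring.Exp commutativeSemiring using (^-distrib-*; ^-congˡ) public
    module reduce = RingMorphisms.IsRingHomomorphism 𝒪.reduce-isHomomorphism
  open TeichmüllerCharacter T

  reduce-^ : ∀ x n → 𝒪.reduce (x 𝒪.^ n) 𝔽.≈ 𝒪.reduce x 𝔽.^ n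
  reduce-^ = ^-homo 𝒪.commutativeRing 𝔽.commutativeRing 𝒪.reduce reduce.1#-homo reduce.*-homo

  reduce-ω^ : ∀ x x≉0 n → 𝒪.reduce (ω x x≉0 𝒪.^ n) 𝔽.≈ x 𝔽.^ n
  reduce-ω^ x x≉0 n = 𝔽.trans (reduce-^ (ω x x≉0) n) (𝔽.^-congˡ n (ω-lift x x≉0))

  fermat : ∀ x → ¬ x 𝔽.≈ 𝔽.0# → x 𝔽.^ (q ℕ.∸ 1) 𝔽.≈ 𝔽.1#
  fermat x x≉0 = 𝔽.trans (𝔽.sym (reduce-ω^ x x≉0 (q ℕ.∸ 1)))
    (𝔽.trans (reduce.⟦⟧-cong (ω-root x x≉0)) reduce.1#-homo)

  ω^*ω̄^≈1 : ∀ x x≉0 n → ω x x≉0 𝒪.^ n 𝒪.* ω̄ x x≉0 𝒪.^ n 𝒪.≈ 𝒪.1#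
  ω^*ω̄^≈1 x x≉0 n = 𝒪.trans (𝒪.sym (𝒪.^-distrib-* (ω x x≉0) (ω̄ x x≉0) n))
    (𝒪.trans (𝒪.^-congˡ n (ω-inverse x x≉0)) (1^n≈1 𝒪.commutativeRing n))

  ω̄-root : ∀ x x≉0 → ω̄ x x≉0 𝒪.^ (q ℕ.∸ 1) 𝒪.≈ 𝒪.1#
  ω̄-root x x≉0 = 𝒪.trans (𝒪.sym (𝒪.*-identityˡ _))
    (𝒪.trans (𝒪.*-congʳ (𝒪.sym (ω-root x x≉0))) (ω^*ω̄^≈1 x x≉0 (q ℕ.∸ 1)))

  -- Only ω comes with a prescribed reduction. Multiplying by the n-th power of ω, which is inverse
  -- to that of ω̄, transfers the information.
  reduce-ω̄^≈1⇒^≈1 : ∀ x x≉0 n → 𝒪.reduce (ω̄ x x≉0 𝒪.^ n) 𝔽.≈ 𝔽.1# → x 𝔽.^ n 𝔽.≈ 𝔽.1#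
  reduce-ω̄^≈1⇒^≈1 x x≉0 n e = begin
    x 𝔽.^ n                                                      ≈⟨ reduce-ω^ x x≉0 n ⟨
    𝒪.reduce (ω x x≉0 𝒪.^ n)                                     ≈⟨ 𝔽.*-identityʳ _ ⟨
    𝒪.reduce (ω x x≉0 𝒪.^ n) 𝔽.* 𝔽.1#                            ≈⟨ 𝔽.*-congˡ e ⟨
    𝒪.reduce (ω x x≉0 𝒪.^ n) 𝔽.* 𝒪.reduce (ω̄ x x≉0 𝒪.^ n)        ≈⟨ reduce.*-homo _ _ ⟨
    𝒪.reduce (ω x x≉0 𝒪.^ n 𝒪.* ω̄ x x≉0 𝒪.^ n)                   ≈⟨ reduce.⟦⟧-cong (ω^*ω̄^≈1 x x≉0 n) ⟩
    𝒪.reduce 𝒪.1#                                                ≈⟨ reduce.1#-homo ⟩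
    𝔽.1#                                                         ∎
    where open Relation.Binary.Reasoning.Setoid 𝔽.setoid

  -- `ω̄^` takes its proof that x is nonzero from the decision procedure. Handing out that proof
  -- presents all its values as powers of one element.
  ω̄^-power : ∀ x → ¬ x 𝔽.≈ 𝔽.0# → ∃ λ x≉0 → ∀ j → ω̄^ j x ≡ ω̄ x x≉0 𝒪.^ j
  ω̄^-power x x≉0 with x 𝔽.≈? 𝔽.0#
  ... | yes x≈0 = contradiction x≈0 x≉0
  ... | no  x≉0 = x≉0 , λ j → refl

-- Periodicity of the factors and of the summands

-- In ₘGₘ, N is q - 1 and d k is pᵏ; of Γ, Γ⁻¹ and π^ = (-p)^ only the homomorphism property of π^ matters.
module Periodicity {c ℓ} (K : CommutativeRing c ℓ) where

  open CommutativeRing K hiding (refl; zero)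
  private
    module ∏ where
      open FiniteSum *-commutativeMonoid public
      open Algebra.Properties.CommutativeMonoid.Sum *-commutativeMonoid public
    module ∑ = FiniteSum +-commutativeMonoid
  open Algebra.Properties.CommutativeSemigroup *-commutativeSemigroup using (interchange; x∙yz≈y∙xz)
  open Algebra.Properties.Semiring.Exp semiring using (_^_; ^-homo-*)
  open Relation.Binary.Reasoning.Setoid setoid
  open Algebra.Properties.Monoid.Sum +-monoid using () renaming (sum to ∑[]; sum-cong-≋ to ∑-cong)
  open Algebra.Properties.Monoid.Sum *-monoid using () renaming (sum to ∏[]; sum-cong-≋ to ∏-cong)

  module Factors
    (Γ Γ⁻¹ : ℚ → Carrier) (π^_ : ℤ → Carrier) (π^-+ : ∀ i j → π^ (i ℤ.+ j) ≈ π^ i * π^ j)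
    (d : ℕ → ℕ) (dℚ : ℕ → ℚ) (dℚ≡ : ∀ k → dℚ k ≡ + d k ℚ./ 1)
    (N : ℕ) .{{_ : NonZero N}} (j/N : ℕ → ℚ) (j/N≡ : ∀ j → j/N j ≡ + j ℚ./ N) where

    factor : ℚ → ℚ → ℕ → ℕ → Carrier
    factor a b j k =
        (Γ ⟨ (a ℚ.- j/N j) ℚ.* dℚ k ⟩ * Γ⁻¹ ⟨ a ℚ.* dℚ k ⟩)
      * (Γ ⟨ (ℚ.- b ℚ.+ j/N j) ℚ.* dℚ k ⟩ * Γ⁻¹ ⟨ ℚ.- b ℚ.* dℚ k ⟩)
      * π^ (ℤ.- floor (⟨ a ℚ.* dℚ k ⟩ ℚ.- j/N j ℚ.* dℚ k)
            ℤ.- floor (⟨ ℚ.- b ℚ.* dℚ k ⟩ ℚ.+ j/N j ℚ.* dℚ k))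

    -- The parts of a factor that do and do not depend on j.
    varying fixed : ℚ → ℚ → Carrier
    varying x y = Γ ⟨ x ⟩ * Γ ⟨ y ⟩ * π^ (ℤ.- floor x ℤ.- floor y)
    fixed x y   = Γ⁻¹ ⟨ x ⟩ * Γ⁻¹ ⟨ y ⟩ * π^ (floor x ℤ.+ floor y)

    varying-periodic : ∀ x y k → varying (x ℚ.+ k ℚ./ 1) (y ℚ.+ (ℤ.- k) ℚ./ 1) ≡ varying x y
    varying-periodic x y k = cong₂ (λ u i → u * π^ i)
      (cong₂ (λ u v → Γ u * Γ v) (⟨⟩-+-/1 x k) (⟨⟩-+-/1 y (ℤ.- k)))
      (≡.trans (cong₂ (λ i j → ℤ.- i ℤ.- j) (floor-+-/1 x k) (floor-+-/1 y (ℤ.- k))) (lem (floor x) (floor y) k))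
      where
      lem : ∀ i j k → ℤ.- (i ℤ.+ k) ℤ.- (j ℤ.+ ℤ.- k) ≡ ℤ.- i ℤ.- j
      lem = solve-∀

    varyingAt : ℚ → ℚ → ℚ → ℕ → Carrier
    varyingAt a b y k = varying ((a ℚ.- y) ℚ.* dℚ k) ((ℚ.- b ℚ.+ y) ℚ.* dℚ k)

    fixedAt : ℚ → ℚ → ℕ → Carrier
    fixedAt a b k = fixed (a ℚ.* dℚ k) (ℚ.- b ℚ.* dℚ k)

    -- The integers split off by `floor-⟨⟩+` are free of j and π^ is a homomorphism, so they can be
    -- collected in `fixedAt`. What remains involves a and b only through a - j/N and - b + j/N.
    factor-split : ∀ a b j k → factor a b j k ≈ fixedAt a b k * varyingAt a b (j/N j) k
    factor-split a b j k = begin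
      factor a b j k
        ≈⟨ *-congˡ (trans (reflexive (cong π^_ exponent)) (π^-+ _ _)) ⟩
      (Γ ⟨ x′ ⟩ * Γ⁻¹ ⟨ x ⟩) * (Γ ⟨ y′ ⟩ * Γ⁻¹ ⟨ y ⟩) * (E * E′)
        ≈⟨ *-cong (trans (interchange _ _ _ _) (*-comm _ _)) (CommutativeRing.refl K) ⟩
      (Γ⁻¹ ⟨ x ⟩ * Γ⁻¹ ⟨ y ⟩) * (Γ ⟨ x′ ⟩ * Γ ⟨ y′ ⟩) * (E * E′)
        ≈⟨ interchange _ _ _ _ ⟩
      fixed x y * varying x′ y′ ∎
      where
      P s x y x′ y′ : ℚ
      P = dℚ k
      s = j/N j
      x = a ℚ.* P
      y = ℚ.- b ℚ.* P
      x′ = (a ℚ.- s) ℚ.* P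
      y′ = (ℚ.- b ℚ.+ s) ℚ.* P
      E E′ : Carrier
      E = π^ (floor x ℤ.+ floor y)
      E′ = π^ (ℤ.- floor x′ ℤ.- floor y′)

      lem₁ : ∀ a s P → a ℚ.* P ℚ.+ ℚ.- (s ℚ.* P) ≡ (a ℚ.- s) ℚ.* P
      lem₁ = solve 3 (λ a s P → a :* P :+ (:- (s :* P)) := (a :- s) :* P) refl
        where open +-*-Solver
      lem₃ : ∀ i j k l → ℤ.- (i ℤ.- k) ℤ.- (j ℤ.- l) ≡ (k ℤ.+ l) ℤ.+ (ℤ.- i ℤ.- j)
      lem₃ = solve-∀

      exponent : ℤ.- floor (⟨ x ⟩ ℚ.- s ℚ.* P) ℤ.- floor (⟨ y ⟩ ℚ.+ s ℚ.* P) ≡ (floor x ℤ.+ floor y) ℤ.+ (ℤ.- floor x′ ℤ.- floor y′)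
      exponent = ≡.trans
        (cong₂ (λ i j → ℤ.- i ℤ.- j)
          (≡.trans (floor-⟨⟩+ x (ℚ.- (s ℚ.* P))) (cong (λ z → floor z ℤ.- floor x) (lem₁ a s P)))
          (≡.trans (floor-⟨⟩+ y (s ℚ.* P)) (cong (λ z → floor z ℤ.- floor y) (≡.sym (ℚP.*-distribʳ-+ P (ℚ.- b) s)))))
        (lem₃ (floor x′) (floor y′) (floor x) (floor y))

    -- Raising a and b by 1 moves the integer `d k` from the second argument of `varying` to the
    -- first.
    varyingAt-periodic : ∀ a b y k → varyingAt (a ℚ.+ ℚ.1ℚ) (b ℚ.+ ℚ.1ℚ) y k ≡ varyingAt a b y k
    varyingAt-periodic a b y k = ≡.trans
      (cong₂ varying
        (≡.trans (lem₁ a y (dℚ k)) (cong ((a ℚ.- y) ℚ.* dℚ k ℚ.+_) (dℚ≡ k)))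
        (≡.trans (lem₂ b y (dℚ k)) (cong ((ℚ.- b ℚ.+ y) ℚ.* dℚ k ℚ.+_)
          (≡.trans (cong ℚ.-_ (dℚ≡ k)) (≡.sym (neg-/1 (+ d k)))))))
      (varying-periodic ((a ℚ.- y) ℚ.* dℚ k) ((ℚ.- b ℚ.+ y) ℚ.* dℚ k) (+ d k))
      where
      open +-*-Solver
      lem₁ : ∀ a y P → (a ℚ.+ ℚ.1ℚ ℚ.- y) ℚ.* P ≡ (a ℚ.- y) ℚ.* P ℚ.+ P
      lem₁ = solve 3 (λ a y P → (a :+ con ℚ.1ℚ :- y) :* P := (a :- y) :* P :+ P) refl
      lem₂ : ∀ b y P → (ℚ.- (b ℚ.+ ℚ.1ℚ) ℚ.+ y) ℚ.* P ≡ (ℚ.- b ℚ.+ y) ℚ.* P ℚ.+ ℚ.- P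
      lem₂ = solve 3 (λ b y P → ((:- (b :+ con ℚ.1ℚ)) :+ y) :* P := ((:- b) :+ y) :* P :+ (:- P)) refl

    varyingAt-translate : ∀ a b y d k → varyingAt (a ℚ.+ d) (b ℚ.+ d) (d ℚ.+ y) k ≡ varyingAt a b y k
    varyingAt-translate a b y d k = cong₂ (λ u v → varying (u ℚ.* dℚ k) (v ℚ.* dℚ k)) (lem₁ a d y) (lem₂ b d y)
      where
      open +-*-Solver
      lem₁ : ∀ a d y → a ℚ.+ d ℚ.- (d ℚ.+ y) ≡ a ℚ.- y
      lem₁ = solve 3 (λ a d y → a :+ d :- (d :+ y) := a :- y) refl
      lem₂ : ∀ b d y → ℚ.- (b ℚ.+ d) ℚ.+ (d ℚ.+ y) ≡ ℚ.- b ℚ.+ y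
      lem₂ = solve 3 (λ b d y → (:- (b :+ d)) :+ (d :+ y) := (:- b) :+ y) refl

    module _ (n : ℕ) .{{_ : NonZero n}} {m} (a b : Fin m → ℚ) (r : ℕ) where

      l/n : ℕ → ℚ
      l/n l = + l ℚ./ n

      factors : ℕ → Carrier
      factors j = ∏.sum {n ℕ.* m} (λ i → ∏.sum {r} (λ k → factor (withShifts n a i) (withShifts n b i) j (toℕ k)))

      varyingRow : ℚ → ℕ → Carrier
      varyingRow y l = ∏.sum {m} (λ i → ∏.sum {r} (λ k → varyingAt (a i ℚ.+ l/n l) (b i ℚ.+ l/n l) y (toℕ k)))

      fixedRow : ℕ → Carrier
      fixedRow l = ∏.sum {m} (λ i → ∏.sum {r} (λ k → fixedAt (a i ℚ.+ l/n l) (b i ℚ.+ l/n l) (toℕ k)))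

      factors-split : ∀ j → factors j ≈ ∏.partialSum fixedRow n * ∏.partialSum (varyingRow (j/N j)) n
      factors-split j = begin
        factors j
          ≈⟨ ∏.sum-remQuot n {m} (λ l i → ∏.sum {r} (λ k → factor (a i ℚ.+ l/n (toℕ l)) (b i ℚ.+ l/n (toℕ l)) j (toℕ k))) ⟩
        ∏.sum {n} (λ l → ∏.sum {m} (λ i → ∏.sum {r} (λ k → factor (a i ℚ.+ l/n (toℕ l)) (b i ℚ.+ l/n (toℕ l)) j (toℕ k))))
          ≈⟨ ∏.sum-cong-≋ {n} (λ l → row (toℕ l)) ⟩
        ∏.sum {n} (λ l → fixedRow (toℕ l) * varyingRow (j/N j) (toℕ l))
          ≈⟨ ∏.∑-distrib-+ {n} (λ l → fixedRow (toℕ l)) (λ l → varyingRow (j/N j) (toℕ l)) ⟩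
        ∏.partialSum fixedRow n * ∏.partialSum (varyingRow (j/N j)) n ∎
        where
        row : ∀ l → ∏.sum {m} (λ i → ∏.sum {r} (λ k → factor (a i ℚ.+ l/n l) (b i ℚ.+ l/n l) j (toℕ k)))
                  ≈ fixedRow l * varyingRow (j/N j) l
        row l = trans
          (∏.sum-cong-≋ {m} (λ i → trans
            (∏.sum-cong-≋ {r} (λ k → factor-split (a i ℚ.+ l/n l) (b i ℚ.+ l/n l) j (toℕ k)))
            (∏.∑-distrib-+ {r} (λ k → fixedAt (a i ℚ.+ l/n l) (b i ℚ.+ l/n l) (toℕ k))
                               (λ k → varyingAt (a i ℚ.+ l/n l) (b i ℚ.+ l/n l) (j/N j) (toℕ k)))))
          (∏.∑-distrib-+ {m} (λ i → ∏.sum {r} (λ k → fixedAt (a i ℚ.+ l/n l) (b i ℚ.+ l/n l) (toℕ k)))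
                             (λ i → ∏.sum {r} (λ k → varyingAt (a i ℚ.+ l/n l) (b i ℚ.+ l/n l) (j/N j) (toℕ k))))

      rows-cong : ∀ {y y′ l l′} → (∀ a b k → varyingAt (a ℚ.+ l/n l) (b ℚ.+ l/n l) y k ≡ varyingAt (a ℚ.+ l/n l′) (b ℚ.+ l/n l′) y′ k) →
                  varyingRow y l ≈ varyingRow y′ l′
      rows-cong eq = ∏.sum-cong-≋ {m} (λ i → ∏.sum-cong-≋ {r} (λ k → reflexive (eq (a i) (b i) (toℕ k))))

      -- This closes the cycle of the l's: since n/n = 1, the parameters for l = n are those for l =
      -- 0 raised by 1.
      varyingRow-periodic : ∀ y → varyingRow y n ≈ varyingRow y 0
      varyingRow-periodic y = rows-cong {y} {y} {n} {0} (λ a b k → ≡.trans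
        (cong₂ (λ u v → varyingAt u v y k) (lem a) (lem b)) (varyingAt-periodic (a ℚ.+ l/n 0) (b ℚ.+ l/n 0) y k))
        where
        lem : ∀ a → a ℚ.+ l/n n ≡ a ℚ.+ l/n 0 ℚ.+ ℚ.1ℚ
        lem a = ≡.trans (cong (a ℚ.+_) (≡.trans (cong (λ i → i ℚ./ n) (≡.sym (ℤP.+-identityˡ (+ n))))
          (≡.trans (/-distribʳ-+ 0ℤ (+ n) n) (cong (l/n 0 ℚ.+_) (/-cross (+ n) 1ℤ n 1 (ℤP.*-comm (+ n) 1ℤ))))))
          (≡.sym (ℚP.+-assoc a (l/n 0) ℚ.1ℚ))

      module _ (h : ℕ) (N≡hn : N ≡ h ℕ.* n) where

        -- h / (q - 1) = 1 / n, so advancing j by h amounts to lowering l by one.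
        varyingRow-shift : ∀ j l → varyingRow (j/N (h ℕ.+ j)) (suc l) ≈ varyingRow (j/N j) l
        varyingRow-shift j l = rows-cong {j/N (h ℕ.+ j)} {j/N j} {suc l} {l} (λ a b k → ≡.trans
          (≡.trans (cong₂ (λ u v → varyingAt u v (j/N (h ℕ.+ j)) k) (lem a) (lem b))
            (cong (λ y → varyingAt (a ℚ.+ l/n l ℚ.+ l/n 1) (b ℚ.+ l/n l ℚ.+ l/n 1) y k) shift))
          (varyingAt-translate (a ℚ.+ l/n l) (b ℚ.+ l/n l) (j/N j) (l/n 1) k))
          where
          lem : ∀ a → a ℚ.+ l/n (suc l) ≡ a ℚ.+ l/n l ℚ.+ l/n 1
          lem a = ≡.trans (cong (a ℚ.+_) (≡.trans (/-distribʳ-+ 1ℤ (+ l) n) (ℚP.+-comm (l/n 1) (l/n l))))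
            (≡.sym (ℚP.+-assoc a (l/n l) (l/n 1)))

          hn≡N : + h ℤ.* + n ≡ 1ℤ ℤ.* + N
          hn≡N = ≡.trans (≡.sym (ℤP.pos-* h n)) (≡.trans (cong +_ (≡.sym N≡hn)) (≡.sym (ℤP.*-identityˡ (+ N))))

          shift : j/N (h ℕ.+ j) ≡ l/n 1 ℚ.+ j/N j
          shift = ≡.trans (j/N≡ (h ℕ.+ j)) (≡.trans (/-distribʳ-+ (+ h) (+ j) N)
            (cong₂ ℚ._+_ (/-cross (+ h) 1ℤ N n hn≡N) (≡.sym (j/N≡ j))))

        factors-periodic : ∀ j → factors (h ℕ.+ j) ≈ factors j
        factors-periodic j = begin
          factors (h ℕ.+ j)
            ≈⟨ factors-split (h ℕ.+ j) ⟩
          ∏.partialSum fixedRow n * ∏.partialSum (varyingRow (j/N (h ℕ.+ j))) n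
            -- After the rotation every index is a successor, so that each row can be lowered by
            -- `varyingRow-shift`.
            ≈⟨ *-congˡ (∏.partialSum-rotate (varyingRow (j/N (h ℕ.+ j))) n (varyingRow-periodic (j/N (h ℕ.+ j)))) ⟨
          ∏.partialSum fixedRow n * ∏.partialSum (λ l → varyingRow (j/N (h ℕ.+ j)) (suc l)) n
            ≈⟨ *-congˡ (∏.sum-cong-≋ {n} (λ l → varyingRow-shift j (toℕ l))) ⟩
          ∏.partialSum fixedRow n * ∏.partialSum (varyingRow (j/N j)) n
            ≈⟨ factors-split j ⟨
          factors j ∎

        module _ (N-even : ∃ λ k → N ≡ 2 ℕ.* k) (χ : ℕ → Carrier) {ζ : Carrier}
                 (χ-shift : ∀ j → χ (h ℕ.+ j) ≈ ζ * χ j) (ζ^n≈1 : ζ ^ n ≈ 1#) where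

          summand : ℕ → Carrier
          summand j = (- 1#) ^ (j ℕ.* (n ℕ.* m)) * χ j * factors j

          -- The exponent grows by h n m = N m, which is even.
          sign-periodic : ∀ j → (- 1#) ^ ((h ℕ.+ j) ℕ.* (n ℕ.* m)) ≈ (- 1#) ^ (j ℕ.* (n ℕ.* m))
          sign-periodic j = begin
            (- 1#) ^ ((h ℕ.+ j) ℕ.* (n ℕ.* m))                   ≡⟨ cong ((- 1#) ^_) exponent ⟩
            (- 1#) ^ (2 ℕ.* (k ℕ.* m) ℕ.+ j ℕ.* (n ℕ.* m))       ≈⟨ ^-homo-* (- 1#) (2 ℕ.* (k ℕ.* m)) (j ℕ.* (n ℕ.* m)) ⟩
            (- 1#) ^ (2 ℕ.* (k ℕ.* m)) * (- 1#) ^ (j ℕ.* (n ℕ.* m))   ≈⟨ *-congʳ (-1^2n≈1 K (k ℕ.* m)) ⟩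
            1# * (- 1#) ^ (j ℕ.* (n ℕ.* m))                      ≈⟨ *-identityˡ _ ⟩
            (- 1#) ^ (j ℕ.* (n ℕ.* m))                           ∎
            where
            k : ℕ
            k = proj₁ N-even
            lem₁ : ∀ h j n m → (h ℕ.+ j) ℕ.* (n ℕ.* m) ≡ h ℕ.* n ℕ.* m ℕ.+ j ℕ.* (n ℕ.* m)
            lem₁ = solve-∀ℕ
            exponent : (h ℕ.+ j) ℕ.* (n ℕ.* m) ≡ 2 ℕ.* (k ℕ.* m) ℕ.+ j ℕ.* (n ℕ.* m)
            exponent = ≡.trans (lem₁ h j n m) (cong (ℕ._+ j ℕ.* (n ℕ.* m))
              (≡.trans (cong (ℕ._* m) (≡.trans (≡.sym N≡hn) (proj₂ N-even))) (ℕP.*-assoc 2 k m)))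

          summand-shift : ∀ j → summand (h ℕ.+ j) ≈ ζ * summand j
          summand-shift j = begin
            (- 1#) ^ ((h ℕ.+ j) ℕ.* (n ℕ.* m)) * χ (h ℕ.+ j) * factors (h ℕ.+ j)
              ≈⟨ *-cong (*-cong (sign-periodic j) (χ-shift j)) (factors-periodic j) ⟩
            (- 1#) ^ (j ℕ.* (n ℕ.* m)) * (ζ * χ j) * factors j
              ≈⟨ *-congʳ (x∙yz≈y∙xz _ ζ (χ j)) ⟩
            ζ * ((- 1#) ^ (j ℕ.* (n ℕ.* m)) * χ j) * factors j
              ≈⟨ *-assoc ζ _ (factors j) ⟩
            ζ * summand j ∎

          sum-fixed : ζ * ∑.partialSum summand N ≈ ∑.partialSum summand N
          sum-fixed = ≡.subst (λ M → ζ * ∑.partialSum summand M ≈ ∑.partialSum summand M)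
            (≡.trans (ℕP.*-comm n h) (≡.sym N≡hn)) (quasiperiodic-sum K n summand-shift ζ^n≈1)

          -- F is meant for the factor in the definition of G. It agrees with `factor` only up to
          -- equality of fractions, since there each quotient of Γ-values is formed in ℤₚ before it
          -- is embedded.
          sum-vanishes : (∀ S → ζ * S ≈ S → S ≈ 0#) →
            ∀ {F : ℚ → ℚ → ℕ → ℕ → Carrier} → (∀ a b j k → F a b j k ≈ factor a b j k) → ∀ e →
            e * ∑[] {N} (λ j → (- 1#) ^ (toℕ j ℕ.* (n ℕ.* m)) * χ (toℕ j)
              * ∏[] {n ℕ.* m} (λ i → ∏[] {r} (λ k → F (withShifts n a i) (withShifts n b i) (toℕ j) (toℕ k)))) ≈ 0#
          sum-vanishes fixed⇒0 F≈factor e = trans (*-congˡ (trans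
            (∑-cong {N} (λ j → *-congˡ (∏-cong {n ℕ.* m} (λ i → ∏-cong {r} (λ k →
              F≈factor (withShifts n a i) (withShifts n b i) (toℕ j) (toℕ k))))))
            (fixed⇒0 (∑.partialSum summand N) sum-fixed))) (zeroʳ e)

open import Data.Nat.Base using (_*_; _^_)

-- Application to the function G

module Concrete
  (p : ℕ) (p-prime : Prime p) (p-odd : p ≢ 2) (r : ℕ) .{{r≢0 : NonZero r}}
  {c₁ ℓ₁ c₂ ℓ₂} {𝔽 : FiniteField c₁ ℓ₁ (p ^ r)}
  (ℤ𝓆 : UnramifiedIntegers p p-prime c₂ ℓ₂ 𝔽) (T : TeichmüllerCharacter p p-prime ℤ𝓆) where

  private
    module 𝒪 = UnramifiedIntegers ℤ𝓆
    module H = Hypergeometric p p-prime p-odd r {{r≢0}} ℤ𝓆 T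
    module ι = RingMorphisms.IsRingHomomorphism 𝒪.ι-isHomomorphism
  open Padic p p-prime
  open Gamma p p-prime p-odd using (Γₚ; Γₚ-unit)
  open Fractions 𝒪.commutativeRing using (Fraction; numerator; denominator; embed; ≈ᶠ-intro)

  embedₚ : ℤₚ → Fraction
  embedₚ x = embed (𝒪.ι x)

  γ γ⁻¹ : ℚ → ℤₚ
  γ x = Γₚ (fromℚ p p-prime x)
  γ⁻¹ x = inverseₚ (γ x) (Γₚ-unit (fromℚ p p-prime x))

  Γ̂ Γ̂⁻¹ : ℚ → Fraction
  Γ̂ x = embedₚ (γ x)
  Γ̂⁻¹ x = embedₚ (γ⁻¹ x)

  product-one : (f g : Fraction) → numerator f 𝒪.* numerator g 𝒪.≈ denominator f 𝒪.* denominator g →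
    CommutativeRing._≈_ H.ℚ𝓆 (CommutativeRing._*_ H.ℚ𝓆 f g) (CommutativeRing.1# H.ℚ𝓆)
  product-one f g e = ≈ᶠ-intro (𝒪.trans (𝒪.*-identityʳ _) (𝒪.trans e (𝒪.sym (𝒪.*-identityˡ _))))

  π 1/π : Fraction
  π   = H.fromℤₚ (fromℤ (+ p))
  1/π = H.1/p

  π^ : ℤ → Fraction
  π^ = H.[-p]^_

  π^-+ : ∀ i j → CommutativeRing._≈_ H.ℚ𝓆 (π^ (i ℤ.+ j)) (CommutativeRing._*_ H.ℚ𝓆 (π^ i) (π^ j))
  π^-+ = ±power-homo H.ℚ𝓆 π 1/π (product-one π 1/π (𝒪.*-comm _ _)) π^
    (λ n → ≈ᶠ-intro 𝒪.refl) (λ n → ≈ᶠ-intro 𝒪.refl)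

  γ-quotient : ∀ {X} x y → (∀ N → residue X N ≡ residue (γ x *ₚ γ⁻¹ y) N mod (p ^ N)) →
    𝒪.ι X 𝒪.≈ 𝒪.ι (γ x) 𝒪.* 𝒪.ι (γ⁻¹ y)
  γ-quotient x y e = 𝒪.trans (ι.⟦⟧-cong (≈ₚ-intro e)) (ι.*-homo (γ x) (γ⁻¹ y))

  -- The units are denominators: each quotient of Γ-values is a single embedded element on one side
  -- of `factor≈` and a product of two on the other.
  cross-multiply : ∀ {A B X X′ Y Y′} u v → A 𝒪.≈ X 𝒪.* X′ → B 𝒪.≈ Y 𝒪.* Y′ →
    (A 𝒪.* B 𝒪.* u) 𝒪.* ((𝒪.1# 𝒪.* 𝒪.1#) 𝒪.* (𝒪.1# 𝒪.* 𝒪.1#) 𝒪.* v)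
      𝒪.≈ ((X 𝒪.* X′) 𝒪.* (Y 𝒪.* Y′) 𝒪.* u) 𝒪.* (𝒪.1# 𝒪.* 𝒪.1# 𝒪.* v)
  cross-multiply u v A≈ B≈ = 𝒪.*-cong (𝒪.*-congʳ (𝒪.*-cong A≈ B≈))
    (𝒪.*-congʳ (𝒪.*-cong (𝒪.*-identityˡ 𝒪.1#) (𝒪.*-identityˡ 𝒪.1#)))

  -- Names the elements of ℤₚ occurring in a factor, so that they can be compared residue by residue below;
  -- comparing them as elements of ℤₚ would unfold their coherence proofs.  The cases N = 0 and N > 0 are
  -- separated there because inverseₚ reduces only when it knows which one holds.
  numerators : ∀ a b j k → ∃ λ A → ∃ λ B → ∃ λ u →
    numerator (H.factor a b j k) 𝒪.≈ 𝒪.ι A 𝒪.* 𝒪.ι B 𝒪.* u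
  numerators a b j k = _ , _ , _ , 𝒪.refl

  p^ℚ j/[q-1] : ℕ → ℚ
  p^ℚ k = + (p ^ k) ℚ./ 1
  j/[q-1] j = (+ j ℚ./ (H.q ℕ.∸ 1)) {{H.q-1≢0}}

  module _ (a b : ℚ) (j k : ℕ) where

    exponent : ℤ
    exponent = ℤ.- floor (⟨ a ℚ.* p^ℚ k ⟩ ℚ.- j/[q-1] j ℚ.* p^ℚ k)
               ℤ.- floor (⟨ ℚ.- b ℚ.* p^ℚ k ⟩ ℚ.+ j/[q-1] j ℚ.* p^ℚ k)

    numerator-a : 𝒪.ι (proj₁ (numerators a b j k))
                  𝒪.≈ 𝒪.ι (γ ⟨ (a ℚ.- j/[q-1] j) ℚ.* p^ℚ k ⟩) 𝒪.* 𝒪.ι (γ⁻¹ ⟨ a ℚ.* p^ℚ k ⟩)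
    numerator-a = γ-quotient ⟨ (a ℚ.- j/[q-1] j) ℚ.* p^ℚ k ⟩ ⟨ a ℚ.* p^ℚ k ⟩
      (λ { zero → mod-1 ; (suc N) → mod-refl })

    numerator-b : 𝒪.ι (proj₁ (proj₂ (numerators a b j k)))
                  𝒪.≈ 𝒪.ι (γ ⟨ (ℚ.- b ℚ.+ j/[q-1] j) ℚ.* p^ℚ k ⟩) 𝒪.* 𝒪.ι (γ⁻¹ ⟨ ℚ.- b ℚ.* p^ℚ k ⟩)
    numerator-b = γ-quotient ⟨ (ℚ.- b ℚ.+ j/[q-1] j) ℚ.* p^ℚ k ⟩ ⟨ ℚ.- b ℚ.* p^ℚ k ⟩
      (λ { zero → mod-1 ; (suc N) → mod-refl })

    factor≈ : CommutativeRing._≈_ H.ℚ𝓆 (H.factor a b j k)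
      (Periodicity.Factors.factor H.ℚ𝓆 Γ̂ Γ̂⁻¹ π^ π^-+ (p ^_) p^ℚ (λ _ → refl)
        (H.q ℕ.∸ 1) {{H.q-1≢0}} j/[q-1] (λ _ → refl) a b j k)
    factor≈ = ≈ᶠ-intro (cross-multiply (numerator (π^ exponent)) (denominator (π^ exponent)) numerator-a numerator-b)

  module _ (n : ℕ) .{{n≢0 : NonZero n}} (q≡1 : + (p ^ r) ≡ 1ℤ mod n) {m : ℕ} (a b : Fin m → ℚ)
           (t : FiniteField.Carrier 𝔽)
           (t-nonpower : ¬ (∃ λ u → FiniteField._≈_ 𝔽 (FiniteField._^_ 𝔽 u n) t)) where

    private
      module 𝔽 = FiniteField 𝔽
      module T = TeichmüllerCharacter T

    1≤q : 1 ℕ.≤ p ^ r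
    1≤q = ℕ.>-nonZero⁻¹ (p ^ r) {{p^≢0 r}}

    n∣q-1 : n ℕD.∣ p ^ r ℕ.∸ 1
    n∣q-1 = ≡.subst (n ℕD.∣_) (cong ℤ.∣_∣ (ℤP.⊖-≥ 1≤q)) (ℤD.∣⇒∣ᵤ (∣difference q≡1))

    h : ℕ
    h = ℕD.quotient n∣q-1

    q-1≡hn : p ^ r ℕ.∸ 1 ≡ h ℕ.* n
    q-1≡hn = ℕD._∣_.equality n∣q-1

    1+hn≡q : suc (h ℕ.* n) ≡ p ^ r
    1+hn≡q = ≡.trans (cong suc (≡.sym q-1≡hn)) (ℕP.m+[n∸m]≡n 1≤q)

    h≢0 : NonZero h
    h≢0 = ℕP.m*n≢0⇒m≢0 h {{ ≡.subst NonZero q-1≡hn (H.q-1≢0) }}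

    q-1-even : ∃ λ k → p ^ r ℕ.∸ 1 ≡ 2 ℕ.* k
    q-1-even = let k , q≡1+2k = odd-prime-power p-prime p-odd r in k , cong (ℕ._∸ 1) q≡1+2k

    t≉0 : ¬ t 𝔽.≈ 𝔽.0#
    t≉0 t≈0 = t-nonpower (𝔽.0# , 𝔽.trans (0^n≈0 𝔽.commutativeRing n) (𝔽.sym t≈0))

    t≉0′ : ¬ t 𝔽.≈ 𝔽.0#
    t≉0′ = proj₁ (ω̄^-power T t t≉0)

    w z : 𝒪.Carrier
    w = T.ω̄ t t≉0′
    z = w 𝒪.^ h

    ω̄^≡w^ : ∀ j → T.ω̄^ j t ≡ w 𝒪.^ j
    ω̄^≡w^ = proj₂ (ω̄^-power T t t≉0)

    χ : ℕ → Fraction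
    χ j = embed (T.ω̄^ j t)

    χ-shift : ∀ j → CommutativeRing._≈_ H.ℚ𝓆 (χ (h ℕ.+ j))
      (CommutativeRing._*_ H.ℚ𝓆 (embed z) (χ j))
    χ-shift j = ≈ᶠ-intro (𝒪.*-cong (begin
      T.ω̄^ (h ℕ.+ j) t          ≡⟨ ω̄^≡w^ (h ℕ.+ j) ⟩
      w 𝒪.^ (h ℕ.+ j)           ≈⟨ ^-homo-* w h j ⟩
      z 𝒪.* w 𝒪.^ j             ≡⟨ cong (z 𝒪.*_) (ω̄^≡w^ j) ⟨
      z 𝒪.* T.ω̄^ j t            ∎) (𝒪.*-identityˡ 𝒪.1#))
      where
      open Relation.Binary.Reasoning.Setoid 𝒪.setoid
      open Algebra.Properties.Semiring.Exp 𝒪.semiring using (^-homo-*)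

    z^n≈1 : z 𝒪.^ n 𝒪.≈ 𝒪.1#
    z^n≈1 = begin
      (w 𝒪.^ h) 𝒪.^ n           ≈⟨ ^-assocʳ w h n ⟩
      w 𝒪.^ (h ℕ.* n)           ≡⟨ cong (w 𝒪.^_) q-1≡hn ⟨
      w 𝒪.^ (p ^ r ℕ.∸ 1)       ≈⟨ ω̄-root T t t≉0′ ⟩
      𝒪.1#                      ∎
      where
      open Relation.Binary.Reasoning.Setoid 𝒪.setoid
      open Algebra.Properties.Semiring.Exp 𝒪.semiring using (^-assocʳ)

    reduce-z≉1 : ¬ 𝒪.reduce z 𝔽.≈ 𝔽.1#
    reduce-z≉1 e = power≉1 𝔽 (fermat T) n h {{h≢0}} 1+hn≡q t t-nonpower (reduce-ω̄^≈1⇒^≈1 T t t≉0′ h e)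

    G-vanishes : CommutativeRing._≈_ H.ℚ𝓆
      (H.G (n ℕ.* m) (withShifts n {{n≢0}} a) (withShifts n {{n≢0}} b) t)
      (CommutativeRing.0# H.ℚ𝓆)
    G-vanishes = Periodicity.Factors.sum-vanishes H.ℚ𝓆 Γ̂ Γ̂⁻¹ π^ π^-+ (p ^_) p^ℚ (λ _ → refl)
      (H.q ℕ.∸ 1) {{H.q-1≢0}} j/[q-1] (λ _ → refl)
      n {{n≢0}} a b r h q-1≡hn q-1-even χ {embed z} χ-shift
      (Embedding.embed-power≈1 𝒪.commutativeRing z n z^n≈1)
      (Embedding.embed-fixed⇒0 𝒪.commutativeRing (fixed⇒0 ℤ𝓆 reduce-z≉1))
      {H.factor} factor≈
      (H.fromℤₚ (fromℚ p p-prime ((-1ℤ ℚ./ (H.q ℕ.∸ 1)) {{H.q-1≢0}})))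

theorem2p9 : ∀ {c₁ ℓ₁ c₂ ℓ₂ : Level}
    (n : ℕ) .{{_ : NonZero n}}
    (p : ℕ) (p-prime : Prime p) (p-odd : p ≢ 2)
    (r : ℕ) .{{_ : NonZero r}}
    (q≡1 : + (p ^ r) ≡ 1ℤ mod n)
    (𝔽 : FiniteField c₁ ℓ₁ (p ^ r))
    (ℤ𝓆 : UnramifiedIntegers p p-prime c₂ ℓ₂ 𝔽)
    (T : TeichmüllerCharacter p p-prime ℤ𝓆)
    (m : ℕ) .{{_ : NonZero m}}
    (a b : Fin m → ℚ)
    (a-integral : ∀ i → PIntegral p p-prime (a i))
    (b-integral : ∀ i → PIntegral p p-prime (b i))
    (t : FiniteField.Carrier 𝔽) →
    ¬ (∃ λ s → FiniteField._≈_ 𝔽 (FiniteField._^_ 𝔽 s n) t) →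
    let open Hypergeometric p p-prime p-odd r ℤ𝓆 T in
    G (n * m) (withShifts n a) (withShifts n b) t ≈ 0#
theorem2p9 n {{n≢0}} p p-prime p-odd r {{r≢0}} q≡1 𝔽 ℤ𝓆 T m a b _ _ t t-nonpower =
  Concrete.G-vanishes p p-prime p-odd r {{r≢0}} ℤ𝓆 T n {{n≢0}} q≡1 a b t t-nonpower
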